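{- Let $q=1-p=o\!\left(\frac{1}{n^{1.5}}\right)$. Then for all sufficiently large $n\in\mathbb{N}$ we have $u_3(n,p)=u_3'(n,p)=4$.
   Context: $G(n,p)$ is the Erdős–Rényi random graph on $n$ labelled vertices (vertex set $V$), each edge present independently with probability $p=p(n)$; $\mathbb{P}_{n,p}$ is the corresponding probability and $q=1-p$. A diameter graph in $\mathbb{R}^d$ is a graph $(V,E)$ with $V\subset\mathbb{R}^d$ finite and $E=\{\{\mathbf{x},\mathbf{y}\}\subseteq V: |\mathbf{x}-\mathbf{y}|=\operatorname{diam}V\}$, where $\operatorname{diam}V=\max_{\mathbf{x},\mathbf{y}\in V}|\mathbf{x}-\mathbf{y}|$ (Euclidean norm); a graph is a diameter graph in $\mathbb{R}^d$ if it is isomorphic to one. $u_d(n,p)$ is the largest positive integer $k$ such that $\mathbb{P}_{n,p}\big(\exists W\subseteq V,\ |W|=k,\ G[W]$ is a diameter graph in $\mathbb{R}^d$ and $\chi(G[W])=d+1\big)>\frac12$, where $G[W]$ is the induced subgraph; if no such $k$ exists, $u_d(n,p)=0$. $u_d'(n,p)$ is defined identically with the additional requirement that $G[W]$ be connected. -}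

module Defs where

open import Algebra.Bundles using (CommutativeRing)
import Algebra.Construct.NaturalChoice.Max as Max
import Algebra.Properties.Monoid.Mult as MonoidMult
import Algebra.Properties.Monoid.Sum as MonoidSum
import Algebra.Properties.AbelianGroup as AbelianGroupProperties
import Algebra.Properties.Ring as RingProperties
open import Algebra.Structures using (IsCommutativeRing)
open import Axiom.ExcludedMiddle using (ExcludedMiddle)
open import Data.Empty using (⊥)
open import Data.Fin.Base using (Fin; zero; suc)
open import Data.Fin.Subset using (Subset; _∈_; ∣_∣; inside; outside)
open import Data.List.Base as List using (List)
open import Data.Nat.Base as ℕ using (ℕ; zero; suc)
open import Data.Product.Base using (_×_; _,_; ∃; proj₁; proj₂)
open import Data.Sum.Base using (_⊎_; inj₁; inj₂)
open import Data.Vec.Base using ([]; _∷_)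
open import Data.Vec.Functional using (Vector; foldr)
open import Function.Base using (_∘_)
open import Function.Bundles using (_↔_; _⇔_; Inverse)
open import Level using (0ℓ)
open import Relation.Binary.Bundles using (TotalOrder)
open import Relation.Binary.Construct.Closure.ReflexiveTransitive using (Star)
open import Relation.Binary.Core using (Rel)
open import Relation.Binary.Definitions using (Symmetric; Irreflexive)
import Relation.Binary.Reasoning.Setoid as SetoidReasoning
open import Relation.Binary.PropositionalEquality.Core using (_≡_; _≢_; ≢-sym; refl)
open import Relation.Binary.Structures using (IsTotalOrder)
open import Relation.Nullary using (¬_; yes; no; contradiction)
open import Relation.Unary using (Pred; Satisfiable)

-- The axioms of a complete ordered field.  In the presence of excluded middle
-- they determine the field of real numbers up to isomorphism; a setoid
-- equality is allowed so that, for example, Cauchy sequences are a model.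

record Reals : Set₁ where
  infixl 7 _*_
  infixl 6 _+_
  infix  4 _≈_ _≤_
  field
    Carrier           : Set
    _≈_ _≤_           : Rel Carrier 0ℓ
    _+_ _*_           : Carrier → Carrier → Carrier
    -_                : Carrier → Carrier
    0# 1#             : Carrier
    isCommutativeRing : IsCommutativeRing _≈_ _+_ _*_ -_ 0# 1#
    isTotalOrder      : IsTotalOrder _≈_ _≤_
    1≉0               : ¬ (1# ≈ 0#)
    inverse           : ∀ x → ¬ (x ≈ 0#) → ∃ λ y → x * y ≈ 1#
    +-monoˡ-≤         : ∀ z {x y} → x ≤ y → x + z ≤ y + z
    *-nonNegative     : ∀ {x y} → 0# ≤ x → 0# ≤ y → 0# ≤ x * y

  IsUpperBound : Pred Carrier 0ℓ → Carrier → Set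
  IsUpperBound S b = ∀ x → S x → x ≤ b

  field
    supremum : (S : Pred Carrier 0ℓ) → Satisfiable S → ∃ (IsUpperBound S) →
               ∃ λ s → IsUpperBound S s × (∀ b → IsUpperBound S b → s ≤ b)

  commutativeRing : CommutativeRing 0ℓ 0ℓ
  commutativeRing = record { isCommutativeRing = isCommutativeRing }

  totalOrder : TotalOrder 0ℓ 0ℓ 0ℓ
  totalOrder = record { isTotalOrder = isTotalOrder }

-- Excluded middle is needed because real-valued functions are defined by cases on
-- undecidable conditions: below on whether x ≈ 0 or a square root exists, and
-- later, for probabilities, on whether a graph belongs to an event.

module RealOperations (em : ExcludedMiddle 0ℓ) (R : Reals) where

  open Reals R using (inverse; isTotalOrder; *-nonNegative; +-monoˡ-≤; totalOrder) public
  open CommutativeRing (Reals.commutativeRing R) public renaming (Carrier to ℝ)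
  open TotalOrder totalOrder public
    using (_≤_; total; antisym; ≤-respˡ-≈; ≤-respʳ-≈)
    renaming (refl to ≤-refl; trans to ≤-trans; reflexive to ≤-reflexive)
  open Max totalOrder public using (_⊔_)
  open MonoidSum +-monoid public using (sum)
  open MonoidMult +-monoid public using () renaming (_×_ to _·_)

  infix 4 _<_
  infix 8 _⁻¹

  _<_ : Rel ℝ 0ℓ
  x < y = x ≤ y × ¬ (x ≈ y)

  fromℕ : ℕ → ℝ
  fromℕ n = n · 1#

  abs : ℝ → ℝ
  abs x = x ⊔ - x

  -- The multiplicative inverse, with the convention 0 ⁻¹ = 0.
  _⁻¹ : ℝ → ℝ
  x ⁻¹ with em {x ≈ 0#}
  ... | yes _  = 0#
  ... | no x≉0 = proj₁ (inverse x x≉0)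

  ½ : ℝ
  ½ = (1# + 1#) ⁻¹

  IsSquareRoot : ℝ → ℝ → Set
  IsSquareRoot a r = 0# ≤ r × r * r ≈ a

  -- The non-negative square root.  It exists, by completeness, for every a ≥ 0;
  -- for a < 0 the value is 0.
  √ : ℝ → ℝ
  √ a with em {∃ (IsSquareRoot a)}
  ... | yes (r , _) = r
  ... | no _        = 0#

  infix 4 _=o[_]

  _=o[_] : (ℕ → ℝ) → (ℕ → ℝ) → Set
  f =o[ g ] = ∀ ε → 0# < ε →
    ∃ λ N → ∀ n → N ℕ.≤ n → abs (f n) ≤ ε * abs (g n)

  -- n ^ 1.5
  _^1·5 : ℕ → ℝ
  n ^1·5 = fromℕ n * √ (fromℕ n)

  open RingProperties ring using (-‿distribˡ-*; -‿distribʳ-*)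
  open AbelianGroupProperties +-abelianGroup
    using (⁻¹-involutive; ⁻¹-anti-homo‿-; x∙y⁻¹≈ε⇒x≈y)

  private module ≈-Reasoning = SetoidReasoning setoid

  *-zero-product : ∀ x y → x * y ≈ 0# → ¬ (x ≈ 0#) → y ≈ 0#
  *-zero-product x y xy≈0 x≉0 with inverse x x≉0
  ... | x⁻¹ , xx⁻¹≈1 = begin
    y             ≈⟨ *-identityˡ y ⟨
    1# * y        ≈⟨ *-congʳ (trans (*-comm x⁻¹ x) xx⁻¹≈1) ⟨
    x⁻¹ * x * y   ≈⟨ *-assoc x⁻¹ x y ⟩
    x⁻¹ * (x * y) ≈⟨ *-congˡ xy≈0 ⟩
    x⁻¹ * 0#      ≈⟨ zeroʳ x⁻¹ ⟩
    0#            ∎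
    where open ≈-Reasoning

  difference-of-squares : ∀ x y → (x - y) * (x + y) ≈ x * x - y * y
  difference-of-squares x y = begin
    (x - y) * (x + y)                     ≈⟨ distribʳ (x + y) x (- y) ⟩
    x * (x + y) + - y * (x + y)           ≈⟨ +-cong (distribˡ x x y) (distribˡ (- y) x y) ⟩
    x * x + x * y + (- y * x + - y * y)   ≈⟨ +-assoc (x * x) (x * y) _ ⟩
    x * x + (x * y + (- y * x + - y * y)) ≈⟨ +-congˡ (+-assoc (x * y) (- y * x) (- y * y)) ⟨
    x * x + (x * y + - y * x + - y * y)   ≈⟨ +-congˡ (+-cong cancel (sym (-‿distribˡ-* y y))) ⟩
    x * x + (0# + - (y * y))              ≈⟨ +-congˡ (+-identityˡ _) ⟩
    x * x - y * y                         ∎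
    where
    open ≈-Reasoning
    cancel : x * y + - y * x ≈ 0#
    cancel = begin
      x * y + - y * x   ≈⟨ +-congˡ (-‿distribˡ-* y x) ⟨
      x * y + - (y * x) ≈⟨ +-congˡ (-‿cong (*-comm y x)) ⟩
      x * y + - (x * y) ≈⟨ -‿inverseʳ (x * y) ⟩
      0#                ∎

  +-nonNegative-zeroˡ : ∀ {x y} → 0# ≤ x → 0# ≤ y → x + y ≈ 0# → x ≈ 0#
  +-nonNegative-zeroˡ {x} {y} 0≤x 0≤y x+y≈0 = antisym x≤0 0≤x
    where
    x≤0 : x ≤ 0#
    x≤0 = ≤-respˡ-≈ (+-identityˡ x)
            (≤-respʳ-≈ (trans (+-comm y x) x+y≈0) (+-monoˡ-≤ x 0≤y))

  square-root-unique : ∀ {a b r s} → a ≈ b →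
    IsSquareRoot a r → IsSquareRoot b s → r ≈ s
  square-root-unique {a} {b} {r} {s} a≈b (0≤r , rr≈a) (0≤s , ss≈b)
    with em {r - s ≈ 0#}
  ... | yes r-s≈0 = x∙y⁻¹≈ε⇒x≈y r s r-s≈0
  ... | no  r-s≉0 = trans r≈0 (sym s≈0)
    where
    product≈0 : (r - s) * (r + s) ≈ 0#
    product≈0 = trans (difference-of-squares r s)
      (trans (+-cong (trans rr≈a a≈b) (-‿cong ss≈b)) (-‿inverseʳ b))
    r+s≈0 : r + s ≈ 0#
    r+s≈0 = *-zero-product (r - s) (r + s) product≈0 r-s≉0
    r≈0 : r ≈ 0#
    r≈0 = +-nonNegative-zeroˡ 0≤r 0≤s r+s≈0
    s≈0 : s ≈ 0#
    s≈0 = +-nonNegative-zeroˡ 0≤s 0≤r (trans (+-comm s r) r+s≈0)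

  √-cong : ∀ {a b} → a ≈ b → √ a ≈ √ b
  √-cong {a} {b} a≈b with em {∃ (IsSquareRoot a)} | em {∃ (IsSquareRoot b)}
  ... | yes (r , p)           | yes (s , q)           = square-root-unique a≈b p q
  ... | yes (r , 0≤r , rr≈a)  | no ∄                  =
    contradiction (r , 0≤r , trans rr≈a a≈b) ∄
  ... | no ∄                  | yes (s , 0≤s , ss≈b)  =
    contradiction (s , 0≤s , trans ss≈b (sym a≈b)) ∄
  ... | no _                  | no _                  =
    CommutativeRing.refl (Reals.commutativeRing R)

  Point : ℕ → Set
  Point d = Vector ℝ d

  infix 4 _≋_

  _≋_ : ∀ {d} → Rel (Point d) 0ℓ
  x ≋ y = ∀ i → x i ≈ y i

  ‖_‖ : ∀ {d} → Point d → ℝ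
  ‖ x ‖ = √ (sum (λ i → x i * x i))

  dist : ∀ {d} → Point d → Point d → ℝ
  dist x y = ‖ (λ i → x i - y i) ‖

  dist-sym : ∀ {d} (x y : Point d) → dist x y ≈ dist y x
  dist-sym x y = √-cong (sum-cong-≋ λ i → square-sym (x i) (y i))
    where
    open MonoidSum +-monoid using (sum-cong-≋)
    square-sym : ∀ a b → (a - b) * (a - b) ≈ (b - a) * (b - a)
    square-sym a b = begin
      (a - b) * (a - b)           ≈⟨ ⁻¹-involutive _ ⟨
      - - ((a - b) * (a - b))     ≈⟨ -‿cong (-‿distribˡ-* (a - b) (a - b)) ⟩
      - (- (a - b) * (a - b))     ≈⟨ -‿distribʳ-* (- (a - b)) (a - b) ⟩
      - (a - b) * - (a - b)       ≈⟨ *-cong (⁻¹-anti-homo‿- a b) (⁻¹-anti-homo‿- a b) ⟩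
      (b - a) * (b - a)           ∎
      where open ≈-Reasoning

  -- The largest distance between two (possibly equal) points of a finite
  -- configuration.  Starting the maximum at 0 only matters for the empty one,
  -- since distances are non-negative.
  diam : ∀ {d m} → Vector (Point d) m → ℝ
  diam V = foldr (λ x D → foldr (λ y E → dist x y ⊔ E) 0# V ⊔ D) 0# V

record SimpleGraph : Set₁ where
  field
    Vertex : Set
    Adj    : Rel Vertex 0ℓ
    sym    : Symmetric Adj
    irrefl : Irreflexive _≡_ Adj

open SimpleGraph

infix 4 _≅_

_≅_ : SimpleGraph → SimpleGraph → Set
G ≅ H = ∃ λ (f : Vertex G ↔ Vertex H) →
  ∀ u v → Adj G u v ⇔ Adj H (Inverse.to f u) (Inverse.to f v)

Colourable : SimpleGraph → ℕ → Set
Colourable G k = ∃ λ (c : Vertex G → Fin k) → ∀ {u v} → Adj G u v → c u ≢ c v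

HasChromaticNumber : SimpleGraph → ℕ → Set
HasChromaticNumber G k = Colourable G k × (∀ j → Colourable G j → k ℕ.≤ j)

Connected : SimpleGraph → Set
Connected G = Vertex G × (∀ u v → Star (Adj G) u v)

-- A graph on the vertex set Fin (suc n) is given by the set of those i : Fin n
-- such that suc i is adjacent to zero, together with the graph (on Fin n)
-- induced on the remaining vertices.  Every pair of distinct vertices is
-- represented once, so two graphs are propositionally equal exactly when they
-- have the same edges.

data LabelledGraph : ℕ → Set where
  []  : LabelledGraph 0
  _∷_ : ∀ {n} → Subset n → LabelledGraph n → LabelledGraph (suc n)

Edge : ∀ {n} → LabelledGraph n → Rel (Fin n) 0ℓ
Edge (N ∷ G) zero    zero    = ⊥
Edge (N ∷ G) zero    (suc j) = j ∈ N
Edge (N ∷ G) (suc i) zero    = i ∈ N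
Edge (N ∷ G) (suc i) (suc j) = Edge G i j

Edge-sym : ∀ {n} (G : LabelledGraph n) → Symmetric (Edge G)
Edge-sym (N ∷ G) {zero}  {suc j} e = e
Edge-sym (N ∷ G) {suc i} {zero}  e = e
Edge-sym (N ∷ G) {suc i} {suc j} e = Edge-sym G e

Edge-irrefl : ∀ {n} (G : LabelledGraph n) → Irreflexive _≡_ (Edge G)
Edge-irrefl (N ∷ G) {suc i} refl e = Edge-irrefl G refl e

infix 9 _[_]

_[_] : ∀ {n} → LabelledGraph n → Subset n → SimpleGraph
G [ W ] = record
  { Vertex = ∃ λ i → i ∈ W
  ; Adj    = λ u v → Edge G (proj₁ u) (proj₁ v)
  ; sym    = Edge-sym G
  ; irrefl = λ { refl → Edge-irrefl G refl }
  }

allSubsets : ∀ n → List (Subset n)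
allSubsets zero    = List.[ [] ]
allSubsets (suc n) =
  List.map (outside ∷_) (allSubsets n) List.++ List.map (inside ∷_) (allSubsets n)

allGraphs : ∀ n → List (LabelledGraph n)
allGraphs zero    = List.[ [] ]
allGraphs (suc n) = List.cartesianProductWith _∷_ (allSubsets n) (allGraphs n)

module RandomDiameterGraphs (em : ExcludedMiddle 0ℓ) (R : Reals) where

  open RealOperations em R
    hiding (sym; refl)
  private module ℝ = RealOperations em R

  diameterGraph : ∀ {d m} → Vector (Point d) m → SimpleGraph
  diameterGraph {d} {m} V = record
    { Vertex = Fin m
    ; Adj    = λ i j → i ≢ j × dist (V i) (V j) ≈ diam V
    ; sym    = λ { {i} {j} (i≢j , e) →
                     ≢-sym i≢j , ℝ.trans (dist-sym (V j) (V i)) e }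
    ; irrefl = λ i≡j (i≢j , _) → i≢j i≡j
    }

  IsDiameterGraph : ℕ → SimpleGraph → Set
  IsDiameterGraph d G = ∃ λ m → ∃ λ (V : Vector (Point d) m) →
    (∀ i j → V i ≋ V j → i ≡ j) × G ≅ diameterGraph V

  subsetWeight : ∀ {n} → ℝ → Subset n → ℝ
  subsetWeight p []            = 1#
  subsetWeight p (inside  ∷ N) = p * subsetWeight p N
  subsetWeight p (outside ∷ N) = (1# - p) * subsetWeight p N

  -- The probability of a given graph in G(n,p): a factor p for every edge and a
  -- factor 1 - p for every non-edge.
  weight : ∀ {n} → ℝ → LabelledGraph n → ℝ
  weight p []      = 1#
  weight p (N ∷ G) = subsetWeight p N * weight p G

  indicator : Set → ℝ
  indicator A with em {A}
  ... | yes _ = 1#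
  ... | no  _ = 0#

  ℙ[_,_] : (n : ℕ) → ℝ → Pred (LabelledGraph n) 0ℓ → ℝ
  ℙ[ n , p ] A =
    List.foldr _+_ 0# (List.map (λ G → weight p G * indicator (A G)) (allGraphs n))

  IsLargestPositiveOrZero : Pred ℕ 0ℓ → Pred ℕ 0ℓ
  IsLargestPositiveOrZero P m =
    (1 ℕ.≤ m × P m × (∀ k → 1 ℕ.≤ k → P k → k ℕ.≤ m))
    ⊎ (m ≡ 0 × (∀ k → 1 ℕ.≤ k → ¬ P k))

  -- IsLargestPositiveOrZero determines m uniquely, so u[ d , n , p ]≡ m says
  -- that the quantity u_d(n,p) equals m, and similarly for u′.

  u[_,_,_]≡_ : ℕ → ℕ → ℝ → ℕ → Set
  u[ d , n , p ]≡ m = IsLargestPositiveOrZero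
    (λ k → ½ < ℙ[ n , p ] λ G → ∃ λ W → ∣ W ∣ ≡ k
      × IsDiameterGraph d (G [ W ])
      × HasChromaticNumber (G [ W ]) (suc d)) m

  u′[_,_,_]≡_ : ℕ → ℕ → ℝ → ℕ → Set
  u′[ d , n , p ]≡ m = IsLargestPositiveOrZero
    (λ k → ½ < ℙ[ n , p ] λ G → ∃ λ W → ∣ W ∣ ≡ k
      × IsDiameterGraph d (G [ W ])
      × HasChromaticNumber (G [ W ]) (suc d)
      × Connected (G [ W ])) m

-- Put q = 1 - p.  The expected number of pairs of non-edges with a common vertex is at most
-- n³q² = o(1), so with high probability the complement of G is a matching.  Then two vertices
-- x, y of the same colour in an optimal 4-colouring of G[W] are adjacent to the vertices of a
-- triangle with the other three colours (two non-adjacent colour classes could be merged).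
-- In a diameter graph in ℝ³ the points x and y would both be apexes over an equilateral
-- triangle whose side is the diameter, and distinct such points are too far apart.  So the
-- four colour classes are singletons and |W| ≤ 4.  Conversely four fixed vertices span a K₄,
-- the regular tetrahedron, with probability at least 1 - 16q.
module Submission where

open import Defs
open import Algebra.Bundles using (CommutativeRing)
import Algebra.Construct.NaturalChoice.Max as Max
import Algebra.Properties.AbelianGroup as AbelianGroupProperties
import Algebra.Properties.Monoid.Sum as MonoidSum
import Algebra.Properties.Ring as RingProperties
import Algebra.Properties.Semiring.Mult.TCOptimised as SemiringMult
import Algebra.Solver.Ring as RingSolver
open import Algebra.Solver.Ring.AlmostCommutativeRing
  using (fromCommutativeRing; _-Raw-AlmostCommutative⟶_)
open import Axiom.ExcludedMiddle using (ExcludedMiddle)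
open import Data.Bool.Base using (if_then_else_)
open import Data.Fin.Base using (Fin; zero; suc; punchIn; punchOut)
open import Data.Fin.Patterns using (0F; 1F; 2F)
open import Data.Fin.Properties as Fin
  using (all?; pigeonhole; injective⇒≤; punchOut-injective; punchInᵢ≢i; punchIn-injective)
open import Data.Fin.Subset using (Subset; _∈_; _∉_; ∣_∣; inside; outside; ⊥)
open import Data.Fin.Subset.Properties using (∣⊥∣≡0)
open import Data.Integer.Base as ℤ using (ℤ; +_; -[1+_])
import Data.Integer.Properties as ℤ
open import Data.List.Base as List using (List; []; _∷_; _++_)
open import Data.List.Properties using (map-∘)
open import Data.Maybe.Base as Maybe using (Maybe)
open import Data.Nat.Base as ℕ using (ℕ; zero; suc)
import Data.Nat.Properties as ℕ
open import Data.Product.Base using (_×_; _,_; ∃; proj₁; proj₂; swap)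
open import Data.Sum.Base using (_⊎_; inj₁; inj₂)
open import Data.Vec.Base using ([]; _∷_; here; there)
open import Data.Vec.Functional using (Vector; foldr)
open import Data.Vec.Properties.WithK using ([]=-irrelevant)
open import Function.Base using (_∘_; const; id)
open import Function.Bundles using (_↔_; Inverse; Injection; Equivalence; mk⇔; mk↔ₛ′)
open import Function.Properties.Inverse using (↔⇒↣; ↔-sym)
open import Level using (0ℓ)
open import Relation.Binary.Construct.Closure.ReflexiveTransitive using (Star; _◅_)
open import Relation.Binary.PropositionalEquality as ≡ using (_≡_; _≢_; ≢-sym)
import Relation.Binary.Reasoning.Setoid as SetoidReasoning
open import Relation.Nullary using (¬_; yes; no; contradiction; does)
open import Relation.Nullary.Decidable
  using (dec⇒maybe; from-yes; ¬?; _→-dec_; decidable-stable)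
open import Relation.Unary using (Pred; ∁)
open SimpleGraph using (Vertex; Adj)

-- The exponent 1.5 is the one for which n³q² = (q n^1.5)². No limit is taken: the little-o
-- hypothesis is applied to the single constant 1/64, which bounds 16q by 1/4 and n³q² by 1/64², so
-- that both probabilities fall on the right side of ½. The field is abstract, so the geometry is
-- reduced to polynomial identities in coordinates. With one vertex of the triangle at the origin,
-- let g be the centroid. The vectors x + y - 2g and x - y are both normal to the plane of the
-- triangle, and orthogonal to each other because x and y are equally far from g. The normals form a
-- line, so one of the two vectors vanishes: either x = y, or y is the mirror image of x, and then x
-- and y are further apart than the side. Independence of edges is never stated as such. A labelled
-- graph is built vertex by vertex, its weight is a product along this construction, and each
-- probability is bounded by conditioning on the neighbourhood of the vertex zero.

-- A ring solver with integer coefficients over an abstract commutative ring.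

module IntegerRingSolver (A : CommutativeRing 0ℓ 0ℓ) where

  open CommutativeRing A
  open AbelianGroupProperties +-abelianGroup using (ε⁻¹≈ε; ⁻¹-involutive; ⁻¹-∙-comm)
  open RingProperties ring using (-‿distribˡ-*)
  open SemiringMult semiring using (×-homo-+; ×1-homo-*) renaming (_×_ to _×′_)
  open SetoidReasoning setoid

  -- With this `_×′_`, `1 ×′ 1#` is `1#` by definition, with no trailing zero, so solver literals
  -- unfold to `1#`, `1# + 1#`, `1# + 1# + 1#`.
  fromℤ : ℤ → Carrier
  fromℤ (+ n)    = n ×′ 1#
  fromℤ -[1+ n ] = - (suc n ×′ 1#)

  fromℤ-neg : ∀ i → fromℤ (ℤ.- i) ≈ - fromℤ i
  fromℤ-neg (+ zero)  = sym ε⁻¹≈ε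
  fromℤ-neg (+ suc n) = refl
  fromℤ-neg -[1+ n ]  = sym (⁻¹-involutive _)

  fromℤ-⊖ : ∀ m n → fromℤ (m ℤ.⊖ n) ≈ m ×′ 1# - n ×′ 1#
  fromℤ-⊖ m zero = begin
    m ×′ 1#      ≈⟨ +-identityʳ _ ⟨
    m ×′ 1# + 0# ≈⟨ +-congˡ ε⁻¹≈ε ⟨
    m ×′ 1# - 0# ∎
  fromℤ-⊖ zero (suc n) = sym (+-identityˡ _)
  fromℤ-⊖ (suc m) (suc n) = begin
    fromℤ (suc m ℤ.⊖ suc n)         ≡⟨ ≡.cong fromℤ (ℤ.[1+m]⊖[1+n]≡m⊖n m n) ⟩
    fromℤ (m ℤ.⊖ n)                 ≈⟨ fromℤ-⊖ m n ⟩
    x - y                           ≈⟨ +-congˡ (+-identityˡ (- y)) ⟨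
    x + (0# - y)                    ≈⟨ +-congˡ (+-congʳ (-‿inverseʳ 1#)) ⟨
    x + (1# - 1# - y)               ≈⟨ +-congˡ (+-assoc 1# (- 1#) (- y)) ⟩
    x + (1# + (- 1# - y))           ≈⟨ +-assoc x 1# _ ⟨
    x + 1# + (- 1# - y)             ≈⟨ +-cong (+-comm x 1#) (⁻¹-∙-comm 1# y) ⟩
    1# + x - (1# + y)               ≈⟨ +-cong (×-homo-+ 1# 1 m) (-‿cong (×-homo-+ 1# 1 n)) ⟨
    suc m ×′ 1# - suc n ×′ 1#       ∎
    where
    x = m ×′ 1#
    y = n ×′ 1#

  fromℤ-+ : ∀ i j → fromℤ (i ℤ.+ j) ≈ fromℤ i + fromℤ j
  fromℤ-+ (+ m)    (+ n)    = ×-homo-+ 1# m n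
  fromℤ-+ (+ m)    -[1+ n ] = fromℤ-⊖ m (suc n)
  fromℤ-+ -[1+ m ] (+ n)    = trans (fromℤ-⊖ n (suc m)) (+-comm _ _)
  fromℤ-+ -[1+ m ] -[1+ n ] = begin
    - (suc (suc (m ℕ.+ n)) ×′ 1#)   ≡⟨ ≡.cong (λ k → - (k ×′ 1#)) (ℕ.+-suc (suc m) n) ⟨
    - ((suc m ℕ.+ suc n) ×′ 1#)     ≈⟨ -‿cong (×-homo-+ 1# (suc m) (suc n)) ⟩
    - (suc m ×′ 1# + suc n ×′ 1#)   ≈⟨ ⁻¹-∙-comm _ _ ⟨
    - (suc m ×′ 1#) - suc n ×′ 1#   ∎

  fromℤ-* : ∀ i j → fromℤ (i ℤ.* j) ≈ fromℤ i * fromℤ j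
  fromℤ-*-pos : ∀ m j → fromℤ (+ m ℤ.* j) ≈ fromℤ (+ m) * fromℤ j

  fromℤ-*-neg : ∀ i j → fromℤ (i ℤ.* j) ≈ fromℤ i * fromℤ j →
                fromℤ (ℤ.- i ℤ.* j) ≈ - fromℤ i * fromℤ j
  fromℤ-*-neg i j eq = begin
    fromℤ (ℤ.- i ℤ.* j)     ≡⟨ ≡.cong fromℤ (ℤ.neg-distribˡ-* i j) ⟨
    fromℤ (ℤ.- (i ℤ.* j))   ≈⟨ fromℤ-neg (i ℤ.* j) ⟩
    - fromℤ (i ℤ.* j)       ≈⟨ -‿cong eq ⟩
    - (fromℤ i * fromℤ j)   ≈⟨ -‿distribˡ-* _ _ ⟩
    - fromℤ i * fromℤ j     ∎

  fromℤ-*-pos m (+ n) = begin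
    fromℤ (+ m ℤ.* + n)     ≡⟨ ≡.cong fromℤ (ℤ.pos-* m n) ⟨
    (m ℕ.* n) ×′ 1#         ≈⟨ ×1-homo-* m n ⟩
    m ×′ 1# * n ×′ 1#       ∎
  fromℤ-*-pos m -[1+ n ] = begin
    fromℤ (+ m ℤ.* -[1+ n ])      ≡⟨ ≡.cong fromℤ (ℤ.*-comm (+ m) -[1+ n ]) ⟩
    fromℤ (-[1+ n ] ℤ.* + m)      ≈⟨ fromℤ-*-neg (+ suc n) (+ m) (fromℤ-*-pos (suc n) (+ m)) ⟩
    - (suc n ×′ 1#) * m ×′ 1#     ≈⟨ *-comm _ _ ⟩
    m ×′ 1# * - (suc n ×′ 1#)     ∎

  fromℤ-* (+ m)    j = fromℤ-*-pos m j
  fromℤ-* -[1+ m ] j = fromℤ-*-neg (+ suc m) j (fromℤ-*-pos (suc m) j)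

  fromℤ-homomorphism : ℤ.+-*-rawRing -Raw-AlmostCommutative⟶ fromCommutativeRing A
  fromℤ-homomorphism = record
    { ⟦_⟧    = fromℤ
    ; +-homo = fromℤ-+
    ; *-homo = fromℤ-*
    ; -‿homo = fromℤ-neg
    ; 0-homo = refl
    ; 1-homo = refl
    }

  -- Only a semi-decision: in an abstract ring distinct integers may have equal images, so nothing
  -- is claimed when they differ.
  fromℤ-≟ : ∀ i j → Maybe (fromℤ i ≈ fromℤ j)
  fromℤ-≟ i j = Maybe.map (reflexive ∘ ≡.cong fromℤ) (dec⇒maybe (i ℤ.≟ j))

  open RingSolver ℤ.+-*-rawRing (fromCommutativeRing A) fromℤ-homomorphism fromℤ-≟
    public using (solve; con; _:=_; _:+_; _:*_; _:-_; :-_)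

-- Order and square roots in a complete ordered field.

module RealProperties (em : ExcludedMiddle 0ℓ) (R : Reals) where

  open RealOperations em R
  open IntegerRingSolver (Reals.commutativeRing R)
  open SetoidReasoning setoid
  open Max totalOrder using (x≤x⊔y; x≤y⊔x; x≤y⇒y⊔x≈y; ⊔-lub) public

  x≤y⇒0≤y-x : ∀ {x y} → x ≤ y → 0# ≤ y - x
  x≤y⇒0≤y-x {x} x≤y = ≤-respˡ-≈ (-‿inverseʳ x) (+-monoˡ-≤ (- x) x≤y)

  -- Reduces an inequality to a ring identity: the difference is exhibited as an expression known to
  -- be non-negative, and the solver checks the identity.
  ≤-by-difference : ∀ {x y d} → 0# ≤ d → y - x ≈ d → x ≤ y
  ≤-by-difference {x} {y} {d} 0≤d y-x≈d = ≤-respˡ-≈ (+-identityˡ x)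
    (≤-respʳ-≈ (trans (+-congʳ (sym y-x≈d)) (solve 2 (λ x y → y :- x :+ x := y) refl x y))
      (+-monoˡ-≤ x 0≤d))

  x-y≈0⇒x≈y : ∀ {x y} → x - y ≈ 0# → x ≈ y
  x-y≈0⇒x≈y {x} {y} x-y≈0 = trans (solve 2 (λ x y → x := x :- y :+ y) refl x y)
    (trans (+-congʳ x-y≈0) (+-identityˡ y))

  +-nonNegative : ∀ {x y} → 0# ≤ x → 0# ≤ y → 0# ≤ x + y
  +-nonNegative {x} {y} 0≤x 0≤y =
    ≤-trans 0≤y (≤-respˡ-≈ (+-identityˡ y) (+-monoˡ-≤ y 0≤x))

  +-mono-≤ : ∀ {w x y z} → w ≤ x → y ≤ z → w + y ≤ x + z
  +-mono-≤ {w} {x} {y} {z} w≤x y≤z = ≤-by-difference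
    (+-nonNegative (x≤y⇒0≤y-x w≤x) (x≤y⇒0≤y-x y≤z))
    (solve 4 (λ w x y z → x :+ z :- (w :+ y) := x :- w :+ (z :- y)) refl w x y z)

  *-monoˡ-≤ : ∀ {x y z} → 0# ≤ x → y ≤ z → x * y ≤ x * z
  *-monoˡ-≤ {x} {y} {z} 0≤x y≤z = ≤-by-difference
    (*-nonNegative 0≤x (x≤y⇒0≤y-x y≤z))
    (solve 3 (λ x y z → x :* z :- x :* y := x :* (z :- y)) refl x y z)

  *-monoʳ-≤ : ∀ {x y z} → 0# ≤ x → y ≤ z → y * x ≤ z * x
  *-monoʳ-≤ {x} {y} {z} 0≤x y≤z =
    ≤-respˡ-≈ (*-comm x y) (≤-respʳ-≈ (*-comm x z) (*-monoˡ-≤ 0≤x y≤z))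

  square-mono-≤ : ∀ {x y} → 0# ≤ x → x ≤ y → x * x ≤ y * y
  square-mono-≤ 0≤x x≤y =
    ≤-trans (*-monoˡ-≤ 0≤x x≤y) (*-monoʳ-≤ (≤-trans 0≤x x≤y) x≤y)

  ≤0⇒0≤- : ∀ {x} → x ≤ 0# → 0# ≤ - x
  ≤0⇒0≤- {x} x≤0 = ≤-respʳ-≈ (+-identityˡ (- x)) (x≤y⇒0≤y-x x≤0)

  square-nonNegative : ∀ x → 0# ≤ x * x
  square-nonNegative x with total 0# x
  ... | inj₁ 0≤x = *-nonNegative 0≤x 0≤x
  ... | inj₂ x≤0 = ≤-respʳ-≈ (solve 1 (λ x → :- x :* :- x := x :* x) refl x)
                     (*-nonNegative (≤0⇒0≤- x≤0) (≤0⇒0≤- x≤0))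

  0≤1 : 0# ≤ 1#
  0≤1 = ≤-respʳ-≈ (*-identityˡ 1#) (square-nonNegative 1#)

  0<1 : 0# < 1#
  0<1 = 0≤1 , λ 0≈1 → Reals.1≉0 R (sym 0≈1)

  <⇒≱ : ∀ {x y} → x < y → ¬ y ≤ x
  <⇒≱ (x≤y , x≉y) y≤x = x≉y (antisym x≤y y≤x)

  ≮⇒≥ : ∀ {x y} → ¬ x < y → y ≤ x
  ≮⇒≥ {x} {y} x≮y with total y x | em {x ≈ y}
  ... | inj₁ y≤x | _       = y≤x
  ... | inj₂ x≤y | yes x≈y = ≤-reflexive (sym x≈y)
  ... | inj₂ x≤y | no x≉y  = contradiction (x≤y , x≉y) x≮y

  ≤-<-trans : ∀ {x y z} → x ≤ y → y < z → x < z
  ≤-<-trans x≤y y<z@(y≤z , _) =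
    ≤-trans x≤y y≤z , λ x≈z → <⇒≱ y<z (≤-respˡ-≈ x≈z x≤y)

  <-≤-trans : ∀ {x y z} → x < y → y ≤ z → x < z
  <-≤-trans x<y@(x≤y , _) y≤z =
    ≤-trans x≤y y≤z , λ x≈z → <⇒≱ x<y (≤-respʳ-≈ (sym x≈z) y≤z)

  x<y⇒0<y-x : ∀ {x y} → x < y → 0# < y - x
  x<y⇒0<y-x (x≤y , x≉y) =
    x≤y⇒0≤y-x x≤y , λ 0≈y-x → x≉y (sym (x-y≈0⇒x≈y (sym 0≈y-x)))

  <-by-difference : ∀ {x y d} → 0# < d → y - x ≈ d → x < y
  <-by-difference {x} {y} (0≤d , 0≉d) y-x≈d = ≤-by-difference 0≤d y-x≈d ,
    λ x≈y → 0≉d (trans (sym (-‿inverseʳ y)) (trans (+-congˡ (-‿cong (sym x≈y))) y-x≈d))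

  *-positive : ∀ {x y} → 0# < x → 0# < y → 0# < x * y
  *-positive {x} {y} (0≤x , 0≉x) (0≤y , 0≉y) = *-nonNegative 0≤x 0≤y ,
    λ 0≈xy → 0≉y (sym (*-zero-product x y (sym 0≈xy) (λ x≈0 → 0≉x (sym x≈0))))

  +-positiveʳ : ∀ {x y} → 0# ≤ x → 0# < y → 0# < x + y
  +-positiveʳ {x} {y} 0≤x 0<y =
    <-≤-trans 0<y (≤-respˡ-≈ (+-identityˡ y) (+-monoˡ-≤ y 0≤x))

  0<2 : 0# < 1# + 1#
  0<2 = +-positiveʳ 0≤1 0<1

  *-cancelˡ-nonNegative : ∀ {x y} → 0# < x → 0# ≤ x * y → 0# ≤ y
  *-cancelˡ-nonNegative {x} {y} 0<x 0≤xy = ≮⇒≥ λ where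
    (y≤0 , y≉0) → <⇒≱ (*-positive 0<x (≤0⇒0≤- y≤0 , λ 0≈-y →
        y≉0 (trans (solve 1 (λ y → y := con (+ 0) :- :- y) refl y)
                   (trans (+-congˡ (-‿cong (sym 0≈-y))) (-‿inverseʳ 0#)))))
      (≤-by-difference 0≤xy (solve 2 (λ x y → con (+ 0) :- x :* :- y := x :* y) refl x y))

  *-cancelˡ-≤ : ∀ {x y z} → 0# < x → x * y ≤ x * z → y ≤ z
  *-cancelˡ-≤ {x} {y} {z} 0<x xy≤xz = ≤-by-difference
    (*-cancelˡ-nonNegative 0<x (≤-respʳ-≈
      (solve 3 (λ x y z → x :* z :- x :* y := x :* (z :- y)) refl x y z) (x≤y⇒0≤y-x xy≤xz)))
    refl

  square-cancel-≤ : ∀ {x y} → 0# ≤ y → x * x ≤ y * y → x ≤ y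
  square-cancel-≤ {x} {y} 0≤y xx≤yy = ≮⇒≥ λ y<x@(y≤x , _) →
    <⇒≱ (*-positive (+-positiveʳ 0≤y (≤-<-trans 0≤y y<x)) (x<y⇒0<y-x y<x))
        (≤-by-difference (x≤y⇒0≤y-x xx≤yy)
          (solve 2 (λ x y → con (+ 0) :- (y :+ x) :* (x :- y) := y :* y :- x :* x) refl x y))

  -- The root is the supremum `s` of the non-negative x with x² ≤ a. The bound 1 + a works because
  -- (1 + a)² - a = 1 + a + a². Each strict inequality between `s * s` and `a` is refuted by a
  -- better bound or a larger member.
  square-root-exists : ∀ {a} → 0# ≤ a → ∃ (IsSquareRoot a)
  square-root-exists {a} 0≤a = s , 0≤s , antisym (≮⇒≥ a≮ss) (≮⇒≥ ss≮a)
    where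
    S : ℝ → Set
    S x = 0# ≤ x × x * x ≤ a

    bounded : Reals.IsUpperBound R S (1# + a)
    bounded x (0≤x , xx≤a) = square-cancel-≤ (+-nonNegative 0≤1 0≤a)
      (≤-trans xx≤a (≤-by-difference
        (+-nonNegative (+-nonNegative 0≤1 0≤a) (square-nonNegative a))
        (solve 1 (λ a → (con (+ 1) :+ a) :* (con (+ 1) :+ a) :- a
                     := con (+ 1) :+ a :+ a :* a) refl a)))

    sup : _
    sup = Reals.supremum R S
      (0# , ≤-refl , ≤-respˡ-≈ (sym (zeroˡ 0#)) 0≤a) (1# + a , bounded)

    s : ℝ
    s = proj₁ sup

    upper : Reals.IsUpperBound R S s
    upper = proj₁ (proj₂ sup)

    least : ∀ b → Reals.IsUpperBound R S b → s ≤ b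
    least = proj₂ (proj₂ sup)

    0≤s : 0# ≤ s
    0≤s = upper 0# (≤-refl , ≤-respˡ-≈ (sym (zeroˡ 0#)) 0≤a)

    -- The Newton iterate b = (s² + a) / 2s satisfies a ≤ b², and b < s if a < s².
    a≮ss : ¬ a < s * s
    a≮ss a<ss = <⇒≱ a<ss (≤-by-difference (x≤y⇒0≤y-x 2ss≤ss+a)
      (solve 2 (λ s a → a :- s :* s := s :* s :+ a :- (s :+ s) :* s) refl s a))
      where
      0<s : 0# < s
      0<s = 0≤s , λ 0≈s → <⇒≱ (≤-<-trans 0≤a a<ss)
        (≤-reflexive (trans (*-congʳ (sym 0≈s)) (zeroˡ s)))
      0<2s : 0# < s + s
      0<2s = +-positiveʳ 0≤s 0<s
      inv : ∃ λ y → (s + s) * y ≈ 1#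
      inv = inverse (s + s) (λ 2s≈0 → proj₂ 0<2s (sym 2s≈0))
      b : ℝ
      b = proj₁ inv * (s * s + a)
      2sb : (s + s) * b ≈ s * s + a
      2sb = trans (sym (*-assoc _ _ _)) (trans (*-congʳ (proj₂ inv)) (*-identityˡ _))
      0≤b : 0# ≤ b
      0≤b = *-cancelˡ-nonNegative 0<2s
        (≤-respʳ-≈ (sym 2sb) (+-nonNegative (square-nonNegative s) 0≤a))
      a≤bb : a ≤ b * b
      a≤bb = ≤-by-difference (*-cancelˡ-nonNegative (*-positive 0<2s 0<2s)
        (≤-respʳ-≈ (sym eq) (square-nonNegative (s * s - a)))) refl
        where
        eq : (s + s) * (s + s) * (b * b - a) ≈ (s * s - a) * (s * s - a)
        eq = trans (solve 3 (λ s b a → (s :+ s) :* (s :+ s) :* (b :* b :- a)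
                        := (s :+ s) :* b :* ((s :+ s) :* b) :- (s :+ s) :* (s :+ s) :* a)
                      refl s b a)
            (trans (+-congʳ (*-cong 2sb 2sb))
              (solve 2 (λ s a → (s :* s :+ a) :* (s :* s :+ a) :- (s :+ s) :* (s :+ s) :* a
                             := (s :* s :- a) :* (s :* s :- a)) refl s a))
      s≤b : s ≤ b
      s≤b = least b λ x (_ , xx≤a) → square-cancel-≤ 0≤b (≤-trans xx≤a a≤bb)
      2ss≤ss+a : (s + s) * s ≤ s * s + a
      2ss≤ss+a = ≤-respʳ-≈ 2sb (*-monoˡ-≤ (proj₁ 0<2s) s≤b)

    -- With δ = a - s² and h = δ / (2s + 1 + δ) ≤ 1 one has (s + h)² ≤ a.
    ss≮a : ¬ s * s < a
    ss≮a ss<a = proj₂ 0<h (sym (antisym h≤0 (proj₁ 0<h)))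
      where
      δ c : ℝ
      δ = a - s * s
      c = s + s + 1# + δ
      0<δ : 0# < δ
      0<δ = x<y⇒0<y-x ss<a
      0<2s+1 : 0# < s + s + 1#
      0<2s+1 = +-positiveʳ (+-nonNegative 0≤s 0≤s) 0<1
      0<c : 0# < c
      0<c = +-positiveʳ (proj₁ 0<2s+1) 0<δ
      inv : ∃ λ y → c * y ≈ 1#
      inv = inverse c (λ c≈0 → proj₂ 0<c (sym c≈0))
      h : ℝ
      h = proj₁ inv * δ
      ch : c * h ≈ δ
      ch = trans (sym (*-assoc _ _ _)) (trans (*-congʳ (proj₂ inv)) (*-identityˡ _))
      0≤h : 0# ≤ h
      0≤h = *-cancelˡ-nonNegative 0<c (≤-respʳ-≈ (sym ch) (proj₁ 0<δ))
      0<h : 0# < h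
      0<h = 0≤h , λ 0≈h → proj₂ 0<δ (trans (sym (zeroʳ c)) (trans (*-congˡ 0≈h) ch))
      h≤1 : h ≤ 1#
      h≤1 = *-cancelˡ-≤ 0<c (≤-respˡ-≈ (sym ch) (≤-by-difference (proj₁ 0<2s+1)
        (solve 2 (λ s d → (s :+ s :+ con (+ 1) :+ d) :* con (+ 1) :- d
                       := s :+ s :+ con (+ 1)) refl s δ)))
      -- Replacing δ by c h gives a - (s + h)² = h(1 - h) + hδ, a sum of non-negative terms.
      s+h∈S : S (s + h)
      s+h∈S = +-nonNegative 0≤s 0≤h , ≤-by-difference
        (+-nonNegative (*-nonNegative 0≤h (x≤y⇒0≤y-x h≤1)) (*-nonNegative 0≤h (proj₁ 0<δ)))
        (trans (solve 3 (λ s h a → a :- (s :+ h) :* (s :+ h)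
                          := a :- s :* s :- (s :+ s :+ h) :* h) refl s h a)
          (trans (+-congʳ (sym ch))
            (solve 3 (λ s h d → (s :+ s :+ con (+ 1) :+ d) :* h :- (s :+ s :+ h) :* h
                             := h :* (con (+ 1) :- h) :+ h :* d) refl s h δ)))
      h≤0 : h ≤ 0#
      h≤0 = ≤-by-difference (x≤y⇒0≤y-x (upper (s + h) s+h∈S))
        (solve 2 (λ s h → con (+ 0) :- h := s :- (s :+ h)) refl s h)

  √-isSquareRoot : ∀ {a} → 0# ≤ a → IsSquareRoot a (√ a)
  √-isSquareRoot {a} 0≤a with em {∃ (IsSquareRoot a)}
  ... | yes (_ , root) = root
  ... | no ∄           = contradiction (square-root-exists 0≤a) ∄

  √-nonNegative : ∀ a → 0# ≤ √ a
  √-nonNegative a with em {∃ (IsSquareRoot a)}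
  ... | yes (_ , 0≤r , _) = 0≤r
  ... | no _              = ≤-refl

  *-inverseʳ : ∀ {x} → ¬ x ≈ 0# → x * x ⁻¹ ≈ 1#
  *-inverseʳ {x} x≉0 with em {x ≈ 0#}
  ... | yes x≈0  = contradiction x≈0 x≉0
  ... | no  x≉0′ = proj₂ (inverse x x≉0′)

  abs-nonNegative : ∀ {x} → 0# ≤ x → abs x ≈ x
  abs-nonNegative {x} 0≤x = x≤y⇒y⊔x≈y (≤-trans
    (≤-by-difference 0≤x (solve 1 (λ x → con (+ 0) :- :- x := x) refl x)) 0≤x)

  ½+½≈1 : ½ + ½ ≈ 1#
  ½+½≈1 = trans (+-cong (sym (*-identityˡ ½)) (sym (*-identityˡ ½)))
    (trans (sym (distribʳ ½ 1# 1#)) (*-inverseʳ λ 2≈0 → proj₂ 0<2 (sym 2≈0)))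

  0<½ : 0# < ½
  0<½ = *-cancelˡ-nonNegative 0<2 (≤-respʳ-≈ (sym 2½≈1) 0≤1) , λ 0≈½ →
    proj₂ 0<1 (trans (sym (zeroʳ _)) (trans (*-congˡ 0≈½) 2½≈1))
    where
    2½≈1 : (1# + 1#) * ½ ≈ 1#
    2½≈1 = trans (solve 1 (λ h → con (+ 2) :* h := h :+ h) refl ½) ½+½≈1

  x+x≈y⇒x≈½y : ∀ {x y} → x + x ≈ y → x ≈ ½ * y
  x+x≈y⇒x≈½y {x} {y} eq = begin
    x               ≈⟨ *-identityˡ x ⟨
    1# * x          ≈⟨ *-congʳ ½+½≈1 ⟨
    (½ + ½) * x     ≈⟨ solve 2 (λ h x → (h :+ h) :* x := h :* (x :+ x)) refl ½ x ⟩
    ½ * (x + x)     ≈⟨ *-congˡ eq ⟩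
    ½ * y           ∎

-- Vectors in three dimensions and apexes over an equilateral triangle.

module Geometry (em : ExcludedMiddle 0ℓ) (R : Reals) where

  open RealOperations em R
  open RealProperties em R
  open IntegerRingSolver (Reals.commutativeRing R)
  open SetoidReasoning setoid

  infix 8 _∙_ _⨯_

  _∙_ : Point 3 → Point 3 → ℝ
  u ∙ v = u 0F * v 0F + u 1F * v 1F + u 2F * v 2F

  _⨯_ : Point 3 → Point 3 → Point 3
  (u ⨯ v) 0F = u 1F * v 2F - u 2F * v 1F
  (u ⨯ v) 1F = u 2F * v 0F - u 0F * v 2F
  (u ⨯ v) 2F = u 0F * v 1F - u 1F * v 0F

  ⨯-zeroʳ : ∀ u {v} → (∀ i → v i ≈ 0#) → ∀ i → (u ⨯ v) i ≈ 0#
  ⨯-zeroʳ u {v} v≈0 = λ { 0F → vanish 1F 2F ; 1F → vanish 2F 0F ; 2F → vanish 0F 1F }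
    where
    vanish : ∀ i j → u i * v j - u j * v i ≈ 0#
    vanish i j = trans (+-cong (*-congˡ (v≈0 j)) (-‿cong (*-congˡ (v≈0 i))))
      (solve 2 (λ x y → x :* con (+ 0) :- y :* con (+ 0) := con (+ 0)) refl (u i) (u j))

  -- The "bac - cab" rule. For w orthogonal to b and c it gives w ⨯ (b ⨯ c) = 0.
  triple-product : ∀ w b c i → (w ⨯ (b ⨯ c)) i ≈ b i * w ∙ c - c i * w ∙ b
  triple-product w b c 0F = solve 9 (λ w₀ w₁ w₂ b₀ b₁ b₂ c₀ c₁ c₂ →
      w₁ :* (b₀ :* c₁ :- b₁ :* c₀) :- w₂ :* (b₂ :* c₀ :- b₀ :* c₂)
      := b₀ :* (w₀ :* c₀ :+ w₁ :* c₁ :+ w₂ :* c₂) :- c₀ :* (w₀ :* b₀ :+ w₁ :* b₁ :+ w₂ :* b₂))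
    refl (w 0F) (w 1F) (w 2F) (b 0F) (b 1F) (b 2F) (c 0F) (c 1F) (c 2F)
  triple-product w b c 1F = solve 9 (λ w₀ w₁ w₂ b₀ b₁ b₂ c₀ c₁ c₂ →
      w₂ :* (b₁ :* c₂ :- b₂ :* c₁) :- w₀ :* (b₀ :* c₁ :- b₁ :* c₀)
      := b₁ :* (w₀ :* c₀ :+ w₁ :* c₁ :+ w₂ :* c₂) :- c₁ :* (w₀ :* b₀ :+ w₁ :* b₁ :+ w₂ :* b₂))
    refl (w 0F) (w 1F) (w 2F) (b 0F) (b 1F) (b 2F) (c 0F) (c 1F) (c 2F)
  triple-product w b c 2F = solve 9 (λ w₀ w₁ w₂ b₀ b₁ b₂ c₀ c₁ c₂ →
      w₀ :* (b₂ :* c₀ :- b₀ :* c₂) :- w₁ :* (b₁ :* c₂ :- b₂ :* c₁)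
      := b₂ :* (w₀ :* c₀ :+ w₁ :* c₁ :+ w₂ :* c₂) :- c₂ :* (w₀ :* b₀ :+ w₁ :* b₁ :+ w₂ :* b₂))
    refl (w 0F) (w 1F) (w 2F) (b 0F) (b 1F) (b 2F) (c 0F) (c 1F) (c 2F)

  -- Makes linear independence of b and c readable from inner products alone: for two edges of the
  -- triangle the right-hand side is (2t)² - t² = 3t².
  lagrange : ∀ b c → (b ⨯ c) ∙ (b ⨯ c) ≈ b ∙ b * c ∙ c - b ∙ c * b ∙ c
  lagrange b c = solve 6 (λ b₀ b₁ b₂ c₀ c₁ c₂ →
      (b₁ :* c₂ :- b₂ :* c₁) :* (b₁ :* c₂ :- b₂ :* c₁)
      :+ (b₂ :* c₀ :- b₀ :* c₂) :* (b₂ :* c₀ :- b₀ :* c₂)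
      :+ (b₀ :* c₁ :- b₁ :* c₀) :* (b₀ :* c₁ :- b₁ :* c₀)
      := (b₀ :* b₀ :+ b₁ :* b₁ :+ b₂ :* b₂) :* (c₀ :* c₀ :+ c₁ :* c₁ :+ c₂ :* c₂)
      :- (b₀ :* c₀ :+ b₁ :* c₁ :+ b₂ :* c₂) :* (b₀ :* c₀ :+ b₁ :* c₁ :+ b₂ :* c₂))
    refl (b 0F) (b 1F) (b 2F) (c 0F) (c 1F) (c 2F)

  -- The splitting of w into parts along and perpendicular to n, multiplied by |n|² to avoid
  -- division.
  normal-component : ∀ n w i → n ∙ n * w i ≈ w ∙ n * n i + (n ⨯ (w ⨯ n)) i
  normal-component n w 0F = solve 6 (λ n₀ n₁ n₂ w₀ w₁ w₂ →
      (n₀ :* n₀ :+ n₁ :* n₁ :+ n₂ :* n₂) :* w₀ := (w₀ :* n₀ :+ w₁ :* n₁ :+ w₂ :* n₂) :* n₀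
      :+ (n₁ :* (w₀ :* n₁ :- w₁ :* n₀) :- n₂ :* (w₂ :* n₀ :- w₀ :* n₂)))
    refl (n 0F) (n 1F) (n 2F) (w 0F) (w 1F) (w 2F)
  normal-component n w 1F = solve 6 (λ n₀ n₁ n₂ w₀ w₁ w₂ →
      (n₀ :* n₀ :+ n₁ :* n₁ :+ n₂ :* n₂) :* w₁ := (w₀ :* n₀ :+ w₁ :* n₁ :+ w₂ :* n₂) :* n₁
      :+ (n₂ :* (w₁ :* n₂ :- w₂ :* n₁) :- n₀ :* (w₀ :* n₁ :- w₁ :* n₀)))
    refl (n 0F) (n 1F) (n 2F) (w 0F) (w 1F) (w 2F)
  normal-component n w 2F = solve 6 (λ n₀ n₁ n₂ w₀ w₁ w₂ →
      (n₀ :* n₀ :+ n₁ :* n₁ :+ n₂ :* n₂) :* w₂ := (w₀ :* n₀ :+ w₁ :* n₁ :+ w₂ :* n₂) :* n₂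
      :+ (n₀ :* (w₂ :* n₀ :- w₀ :* n₂) :- n₁ :* (w₁ :* n₂ :- w₂ :* n₁)))
    refl (n 0F) (n 1F) (n 2F) (w 0F) (w 1F) (w 2F)

  orthogonal⇒parallel-⨯ : ∀ b c w → w ∙ b ≈ 0# → w ∙ c ≈ 0# →
    ∀ i → (b ⨯ c) ∙ (b ⨯ c) * w i ≈ w ∙ (b ⨯ c) * (b ⨯ c) i
  orthogonal⇒parallel-⨯ b c w wb≈0 wc≈0 i = begin
    n ∙ n * w i                       ≈⟨ normal-component n w i ⟩
    w ∙ n * n i + (n ⨯ (w ⨯ n)) i     ≈⟨ +-congˡ (⨯-zeroʳ n w⨯n≈0 i) ⟩
    w ∙ n * n i + 0#                  ≈⟨ +-identityʳ _ ⟩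
    w ∙ n * n i                       ∎
    where
    n = b ⨯ c
    w⨯n≈0 : ∀ j → (w ⨯ n) j ≈ 0#
    w⨯n≈0 j = begin
      (w ⨯ n) j                   ≈⟨ triple-product w b c j ⟩
      b j * w ∙ c - c j * w ∙ b   ≈⟨ +-cong (*-congˡ wc≈0) (-‿cong (*-congˡ wb≈0)) ⟩
      b j * 0# - c j * 0#         ≈⟨ +-cong (zeroʳ (b j)) (-‿cong (zeroʳ (c j))) ⟩
      0# - 0#                     ≈⟨ -‿inverseʳ 0# ⟩
      0#                          ∎

  -- A non-zero cross product means that b and c span a plane. Its normals form a line, and two
  -- orthogonal vectors on a line cannot both be non-zero.
  orthogonal⇒zero : ∀ b c u v → ¬ (b ⨯ c) ∙ (b ⨯ c) ≈ 0# →
    u ∙ b ≈ 0# → u ∙ c ≈ 0# → v ∙ b ≈ 0# → v ∙ c ≈ 0# → u ∙ v ≈ 0# →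
    (∀ i → u i ≈ 0#) ⊎ (∀ i → v i ≈ 0#)
  orthogonal⇒zero b c u v N≉0 ub uc vb vc uv = conclude (em {u ∙ n ≈ 0#})
    where
    n = b ⨯ c
    N = n ∙ n
    vanish : ∀ w → w ∙ b ≈ 0# → w ∙ c ≈ 0# → w ∙ n ≈ 0# → ∀ i → w i ≈ 0#
    vanish w wb wc wn i = *-zero-product N (w i)
      (trans (orthogonal⇒parallel-⨯ b c w wb wc i) (trans (*-congʳ wn) (zeroˡ (n i)))) N≉0
    -- Both vectors are multiples of n after scaling by N, so this product equals N² (u ∙ v) up to
    -- one cancelled factor N.
    product : N * (u ∙ n * v ∙ n) ≈ 0#
    product = begin
      N * (u ∙ n * v ∙ n)
        ≈⟨ solve 5 (λ x y n₀ n₁ n₂ → (n₀ :* n₀ :+ n₁ :* n₁ :+ n₂ :* n₂) :* (x :* y)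
             := x :* n₀ :* (y :* n₀) :+ x :* n₁ :* (y :* n₁) :+ x :* n₂ :* (y :* n₂))
             refl (u ∙ n) (v ∙ n) (n 0F) (n 1F) (n 2F) ⟩
      (λ i → u ∙ n * n i) ∙ (λ i → v ∙ n * n i)
        ≈⟨ +-cong (+-cong (eq 0F) (eq 1F)) (eq 2F) ⟩
      (λ i → N * u i) ∙ (λ i → N * v i)
        ≈⟨ solve 7 (λ N u₀ u₁ u₂ v₀ v₁ v₂ →
             N :* u₀ :* (N :* v₀) :+ N :* u₁ :* (N :* v₁) :+ N :* u₂ :* (N :* v₂)
             := N :* N :* (u₀ :* v₀ :+ u₁ :* v₁ :+ u₂ :* v₂))
             refl N (u 0F) (u 1F) (u 2F) (v 0F) (v 1F) (v 2F) ⟩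
      N * N * u ∙ v
        ≈⟨ *-congˡ uv ⟩
      N * N * 0#
        ≈⟨ zeroʳ _ ⟩
      0# ∎
      where
      eq : ∀ i → u ∙ n * n i * (v ∙ n * n i) ≈ N * u i * (N * v i)
      eq i = sym (*-cong (orthogonal⇒parallel-⨯ b c u ub uc i)
                         (orthogonal⇒parallel-⨯ b c v vb vc i))
    conclude : _ → _
    conclude (yes un≈0) = inj₁ (vanish u ub uc un≈0)
    conclude (no un≉0)  = inj₂ (vanish v vb vc
      (*-zero-product (u ∙ n) (v ∙ n) (*-zero-product N _ product N≉0) un≉0))

  distSq : ∀ {d} → Point d → Point d → ℝ
  distSq x y = sum λ i → (x i - y i) * (x i - y i)

  infixl 7 _⊖_
  _⊖_ : ∀ {d} → Point d → Point d → Point d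
  (x ⊖ y) i = x i - y i

  -- Expanding the right-hand side, all squared norms cancel. In the solver term the final
  -- `con (+ 0)` of `d` is the empty tail of `sum` over three coordinates.
  polarisation : ∀ u v a b →
    (u ⊖ v) ∙ (b ⊖ a) + (u ⊖ v) ∙ (b ⊖ a) ≈ distSq u a - distSq u b - (distSq v a - distSq v b)
  polarisation u v a b = solve 12 (λ u₀ u₁ u₂ v₀ v₁ v₂ a₀ a₁ a₂ b₀ b₁ b₂ →
      let ip = (u₀ :- v₀) :* (b₀ :- a₀) :+ (u₁ :- v₁) :* (b₁ :- a₁) :+ (u₂ :- v₂) :* (b₂ :- a₂)
          sq = λ x y → (x :- y) :* (x :- y)
          d = λ x₀ x₁ x₂ y₀ y₁ y₂ → sq x₀ y₀ :+ (sq x₁ y₁ :+ (sq x₂ y₂ :+ con (+ 0)))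
      in ip :+ ip := d u₀ u₁ u₂ a₀ a₁ a₂ :- d u₀ u₁ u₂ b₀ b₁ b₂
           :- (d v₀ v₁ v₂ a₀ a₁ a₂ :- d v₀ v₁ v₂ b₀ b₁ b₂))
    refl (u 0F) (u 1F) (u 2F) (v 0F) (v 1F) (v 2F) (a 0F) (a 1F) (a 2F) (b 0F) (b 1F) (b 2F)

  -- The triangle is 0, b, c with squared side 2t, so edges at 60° have inner product t. The last
  -- hypothesis says that x and y are no further apart than the side, since |x - y|² = 4t - 2 (x ∙
  -- y).
  equilateral-cone : ∀ (b c x y : Point 3) t → 0# < t →
    b ∙ b ≈ t + t → c ∙ c ≈ t + t → x ∙ x ≈ t + t → y ∙ y ≈ t + t →
    b ∙ c ≈ t → x ∙ b ≈ t → x ∙ c ≈ t → y ∙ b ≈ t → y ∙ c ≈ t →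
    t ≤ x ∙ y → x ≋ y
  equilateral-cone b c x y t 0<t bb cc xx yy bc xb xc yb yc t≤xy =
    conclude (orthogonal⇒zero b c v (x ⊖ y) N≉0 v∙b v∙c (w∙ b xb yb) (w∙ c xc yc) v∙w)
    where
    -- Bracketed exactly as the solver literals `con (+ 3)` and `con (+ 2)` unfold.
    3# 2# : ℝ
    2# = 1# + 1#
    3# = 2# + 1#

    -- Three times x + y - 2g, where g = (b + c)/3 is the centroid of the triangle; the factor
    -- clears the denominator.
    v : Point 3
    v i = 3# * (x i + y i) - 2# * (b i + c i)

    v∙-expand : ∀ z → v ∙ z ≈ 3# * (x ∙ z + y ∙ z) - 2# * (b ∙ z + c ∙ z)
    v∙-expand z = solve 15 (λ x₀ x₁ x₂ y₀ y₁ y₂ b₀ b₁ b₂ c₀ c₁ c₂ z₀ z₁ z₂ →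
        let v = λ x y b c → con (+ 3) :* (x :+ y) :- con (+ 2) :* (b :+ c)
            ip = λ x₀ x₁ x₂ → x₀ :* z₀ :+ x₁ :* z₁ :+ x₂ :* z₂
        in ip (v x₀ y₀ b₀ c₀) (v x₁ y₁ b₁ c₁) (v x₂ y₂ b₂ c₂)
           := con (+ 3) :* (ip x₀ x₁ x₂ :+ ip y₀ y₁ y₂)
           :- con (+ 2) :* (ip b₀ b₁ b₂ :+ ip c₀ c₁ c₂))
      refl (x 0F) (x 1F) (x 2F) (y 0F) (y 1F) (y 2F) (b 0F) (b 1F) (b 2F) (c 0F) (c 1F) (c 2F)
           (z 0F) (z 1F) (z 2F)

    ∙-comm : ∀ u w → u ∙ w ≈ w ∙ u
    ∙-comm u w = +-cong (+-cong (*-comm _ _) (*-comm _ _)) (*-comm _ _)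

    v∙-zero : ∀ z {k l} → x ∙ z ≈ t → y ∙ z ≈ t → b ∙ z ≈ k → c ∙ z ≈ l →
      k + l ≈ 3# * t → v ∙ z ≈ 0#
    v∙-zero z {k} {l} xz yz bz cz k+l≈3t = begin
      v ∙ z
        ≈⟨ v∙-expand z ⟩
      3# * (x ∙ z + y ∙ z) - 2# * (b ∙ z + c ∙ z)
        ≈⟨ +-cong (*-congˡ (+-cong xz yz)) (-‿cong (*-congˡ (trans (+-cong bz cz) k+l≈3t))) ⟩
      3# * (t + t) - 2# * (3# * t)
        ≈⟨ solve 1 (λ t → con (+ 3) :* (t :+ t) :- con (+ 2) :* (con (+ 3) :* t) := con (+ 0))
             refl t ⟩
      0# ∎

    v∙b : v ∙ b ≈ 0#
    v∙b = v∙-zero b xb yb bb (trans (∙-comm c b) bc)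
      (solve 1 (λ t → t :+ t :+ t := con (+ 3) :* t) refl t)

    v∙c : v ∙ c ≈ 0#
    v∙c = v∙-zero c xc yc bc cc
      (solve 1 (λ t → t :+ (t :+ t) := con (+ 3) :* t) refl t)

    ⊖-∙ : ∀ u v w → (u ⊖ v) ∙ w ≈ u ∙ w - v ∙ w
    ⊖-∙ u v w = solve 9 (λ u₀ u₁ u₂ v₀ v₁ v₂ w₀ w₁ w₂ →
        (u₀ :- v₀) :* w₀ :+ (u₁ :- v₁) :* w₁ :+ (u₂ :- v₂) :* w₂
        := u₀ :* w₀ :+ u₁ :* w₁ :+ u₂ :* w₂ :- (v₀ :* w₀ :+ v₁ :* w₁ :+ v₂ :* w₂))
      refl (u 0F) (u 1F) (u 2F) (v 0F) (v 1F) (v 2F) (w 0F) (w 1F) (w 2F)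

    w∙ : ∀ z → x ∙ z ≈ t → y ∙ z ≈ t → (x ⊖ y) ∙ z ≈ 0#
    w∙ z xz yz = trans (⊖-∙ x y z) (trans (+-cong xz (-‿cong yz)) (-‿inverseʳ t))

    v∙x : v ∙ x ≈ 2# * t + 3# * x ∙ y
    v∙x = begin
      v ∙ x
        ≈⟨ v∙-expand x ⟩
      3# * (x ∙ x + y ∙ x) - 2# * (b ∙ x + c ∙ x)
        ≈⟨ +-cong (*-congˡ (+-cong xx (∙-comm y x)))
             (-‿cong (*-congˡ (+-cong (trans (∙-comm b x) xb) (trans (∙-comm c x) xc)))) ⟩
      3# * (t + t + x ∙ y) - 2# * (t + t)
        ≈⟨ solve 2 (λ t d → con (+ 3) :* (t :+ t :+ d) :- con (+ 2) :* (t :+ t)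
             := con (+ 2) :* t :+ con (+ 3) :* d) refl t (x ∙ y) ⟩
      2# * t + 3# * x ∙ y ∎

    v∙y : v ∙ y ≈ 2# * t + 3# * x ∙ y
    v∙y = begin
      v ∙ y
        ≈⟨ v∙-expand y ⟩
      3# * (x ∙ y + y ∙ y) - 2# * (b ∙ y + c ∙ y)
        ≈⟨ +-cong (*-congˡ (+-congˡ yy))
             (-‿cong (*-congˡ (+-cong (trans (∙-comm b y) yb) (trans (∙-comm c y) yc)))) ⟩
      3# * (x ∙ y + (t + t)) - 2# * (t + t)
        ≈⟨ solve 2 (λ t d → con (+ 3) :* (d :+ (t :+ t)) :- con (+ 2) :* (t :+ t)
             := con (+ 2) :* t :+ con (+ 3) :* d) refl t (x ∙ y) ⟩
      2# * t + 3# * x ∙ y ∎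

    v∙w : v ∙ (x ⊖ y) ≈ 0#
    v∙w = begin
      v ∙ (x ⊖ y)       ≈⟨ ∙-comm v (x ⊖ y) ⟩
      (x ⊖ y) ∙ v       ≈⟨ ⊖-∙ x y v ⟩
      x ∙ v - y ∙ v     ≈⟨ +-cong (trans (∙-comm x v) v∙x) (-‿cong (trans (∙-comm y v) v∙y)) ⟩
      _ - _             ≈⟨ -‿inverseʳ _ ⟩
      0#                ∎

    N≉0 : ¬ (b ⨯ c) ∙ (b ⨯ c) ≈ 0#
    N≉0 N≈0 = proj₂ (*-positive (+-positiveʳ (proj₁ 0<2) 0<1) (*-positive 0<t 0<t)) (sym (begin
      3# * (t * t)
        ≈⟨ solve 1 (λ t → con (+ 3) :* (t :* t) := (t :+ t) :* (t :+ t) :- t :* t) refl t ⟩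
      (t + t) * (t + t) - t * t
        ≈⟨ +-cong (*-cong bb cc) (-‿cong (*-cong bc bc)) ⟨
      b ∙ b * c ∙ c - b ∙ c * b ∙ c
        ≈⟨ lagrange b c ⟨
      (b ⨯ c) ∙ (b ⨯ c)
        ≈⟨ N≈0 ⟩
      0# ∎))

    conclude : (∀ i → v i ≈ 0#) ⊎ (∀ i → (x ⊖ y) i ≈ 0#) → x ≋ y
    conclude (inj₂ w≈0) i = x-y≈0⇒x≈y (w≈0 i)
    conclude (inj₁ v≈0) = contradiction (begin
        2# * t + 3# * x ∙ y
          ≈⟨ v∙x ⟨
        v ∙ x
          ≈⟨ +-cong (+-cong (*-congʳ (v≈0 0F)) (*-congʳ (v≈0 1F))) (*-congʳ (v≈0 2F)) ⟩
        (λ _ → 0#) ∙ x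
          ≈⟨ solve 3 (λ x y z → con (+ 0) :* x :+ con (+ 0) :* y :+ con (+ 0) :* z := con (+ 0))
               refl (x 0F) (x 1F) (x 2F) ⟩
        0# ∎)
      λ eq → proj₂ (+-positiveʳ (*-nonNegative (proj₁ 0<2) (proj₁ 0<t))
        (*-positive (+-positiveʳ (proj₁ 0<2) 0<1) (<-≤-trans 0<t t≤xy))) (sym eq)

  distSq-refl : ∀ (p : Point 3) → distSq p p ≈ 0#
  distSq-refl p = solve 3 (λ x y z → (x :- x) :* (x :- x) :+ ((y :- y) :* (y :- y)
    :+ ((z :- z) :* (z :- z) :+ con (+ 0))) := con (+ 0)) refl (p 0F) (p 1F) (p 2F)

  -- Two points at distance √s from the vertices of an equilateral triangle with side √s
  -- are mirror images in its plane, at distance √(8s/3) > √s.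
  no-two-apexes : ∀ {s} (a b c x y : Point 3) → 0# < s →
    distSq a b ≈ s → distSq a c ≈ s → distSq b c ≈ s →
    distSq x a ≈ s → distSq x b ≈ s → distSq x c ≈ s →
    distSq y a ≈ s → distSq y b ≈ s → distSq y c ≈ s →
    distSq x y ≤ s → x ≋ y
  no-two-apexes {s} a b c x y 0<s ab ac bc xa xb xc ya yb yc xy≤s i =
    x-y≈0⇒x≈y (trans (solve 3 (λ a x y → x :- y := (x :- a) :- (y :- a)) refl (a i) (x i) (y i))
      (trans (+-congʳ (equilateral-cone (b ⊖ a) (c ⊖ a) (x ⊖ a) (y ⊖ a) t 0<t
        (ip b b ba ba (distSq-refl b) two-t) (ip c c ca ca (distSq-refl c) two-t)
        (ip x x xa xa (distSq-refl x) two-t) (ip y y ya ya (distSq-refl y) two-t)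
        (ip b c ba ca bc half) (ip x b xa ba xb half) (ip x c xa ca xc half)
        (ip y b ya ba yb half) (ip y c ya ca yc half) t≤xy i)) (-‿inverseʳ _)))
    where
    -- After `a` is moved to the origin, s cos 60° is the inner product of two edges at `a`.
    t : ℝ
    t = ½ * s

    0<t : 0# < t
    0<t = *-positive 0<½ 0<s

    distSq-sym : ∀ p q → distSq p q ≈ distSq q p
    distSq-sym p q = solve 6 (λ x y z x′ y′ z′ →
      let sq = λ x y → (x :- y) :* (x :- y) in
      sq x x′ :+ (sq y y′ :+ (sq z z′ :+ con (+ 0)))
      := sq x′ x :+ (sq y′ y :+ (sq z′ z :+ con (+ 0))))
      refl (p 0F) (p 1F) (p 2F) (q 0F) (q 1F) (q 2F)

    ba : distSq b a ≈ s
    ba = trans (distSq-sym b a) ab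

    ca : distSq c a ≈ s
    ca = trans (distSq-sym c a) ac

    -- The law of cosines at `a` for two sides of squared length s. Taking q = p yields squared
    -- lengths, which is why `distSq-refl` is supplied above.
    double-ip : ∀ p q → distSq p a ≈ s → distSq q a ≈ s →
      (p ⊖ a) ∙ (q ⊖ a) + (p ⊖ a) ∙ (q ⊖ a) ≈ s + s - distSq p q
    double-ip p q pa qa = begin
      _ + _
        ≈⟨ polarisation p a a q ⟩
      distSq p a - distSq p q - (distSq a a - distSq a q)
        ≈⟨ +-cong (+-congʳ pa)
             (-‿cong (+-cong (distSq-refl a) (-‿cong (trans (distSq-sym a q) qa)))) ⟩
      s - distSq p q - (0# - s)
        ≈⟨ solve 2 (λ s d → s :- d :- (con (+ 0) :- s) := s :+ s :- d) refl s (distSq p q) ⟩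
      s + s - distSq p q ∎

    ip : ∀ p q {d e} → distSq p a ≈ s → distSq q a ≈ s → distSq p q ≈ d →
      ½ * (s + s - d) ≈ e → (p ⊖ a) ∙ (q ⊖ a) ≈ e
    ip p q pa qa pq eq = trans
      (x+x≈y⇒x≈½y (trans (double-ip p q pa qa) (+-congˡ (-‿cong pq)))) eq

    two-t : ½ * (s + s - 0#) ≈ t + t
    two-t = solve 2 (λ h s → h :* (s :+ s :- con (+ 0)) := h :* s :+ h :* s) refl ½ s

    half : ½ * (s + s - s) ≈ t
    half = solve 2 (λ h s → h :* (s :+ s :- s) := h :* s) refl ½ s

    t≤xy : t ≤ (x ⊖ a) ∙ (y ⊖ a)
    t≤xy = ≤-respʳ-≈ (sym (ip x y xa ya refl refl)) (*-monoˡ-≤ (proj₁ 0<½)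
      (≤-by-difference (x≤y⇒0≤y-x xy≤s)
        (solve 2 (λ s d → s :+ s :- d :- s := s :- d) refl s (distSq x y))))

-- Common neighbours of a triangle in a diameter graph, and the regular tetrahedron.

module DiameterGraphs (em : ExcludedMiddle 0ℓ) (R : Reals) where

  open RealOperations em R hiding (zero)
  open RandomDiameterGraphs em R using (diameterGraph; IsDiameterGraph)
  open RealProperties em R
  open Geometry em R
  open IntegerRingSolver (Reals.commutativeRing R) using (fromℤ; fromℤ-+; fromℤ-*; fromℤ-neg)

  sum-nonNegative : ∀ {d} (f : Vector ℝ d) → (∀ i → 0# ≤ f i) → 0# ≤ sum f
  sum-nonNegative {zero}  f 0≤f = ≤-refl
  sum-nonNegative {suc d} f 0≤f = +-nonNegative (0≤f zero) (sum-nonNegative (f ∘ suc) (0≤f ∘ suc))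

  sum≈0⇒≈0 : ∀ {d} (f : Vector ℝ d) → (∀ i → 0# ≤ f i) → sum f ≈ 0# → ∀ i → f i ≈ 0#
  sum≈0⇒≈0 f 0≤f eq zero =
    +-nonNegative-zeroˡ (0≤f zero) (sum-nonNegative (f ∘ suc) (0≤f ∘ suc)) eq
  sum≈0⇒≈0 f 0≤f eq (suc i) = sum≈0⇒≈0 (f ∘ suc) (0≤f ∘ suc)
    (+-nonNegative-zeroˡ (sum-nonNegative (f ∘ suc) (0≤f ∘ suc)) (0≤f zero)
      (trans (+-comm _ _) eq)) i

  distSq-nonNegative : ∀ {d} (x y : Point d) → 0# ≤ distSq x y
  distSq-nonNegative x y = sum-nonNegative _ λ i → square-nonNegative (x i - y i)

  distSq≈0⇒≋ : ∀ {d} (x y : Point d) → distSq x y ≈ 0# → x ≋ y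
  distSq≈0⇒≋ x y eq i with em {x i - y i ≈ 0#}
  ... | yes d≈0 = x-y≈0⇒x≈y d≈0
  ... | no  d≉0 = contradiction (*-zero-product _ _
                    (sum≈0⇒≈0 _ (λ j → square-nonNegative (x j - y j)) eq i) d≉0) d≉0

  dist-squared : ∀ {d} (x y : Point d) → dist x y * dist x y ≈ distSq x y
  dist-squared x y = proj₂ (√-isSquareRoot (distSq-nonNegative x y))

  √-mono-≤ : ∀ {a b} → 0# ≤ a → a ≤ b → √ a ≤ √ b
  √-mono-≤ {a} {b} 0≤a a≤b = square-cancel-≤ (√-nonNegative b)
    (≤-respˡ-≈ (sym (proj₂ (√-isSquareRoot 0≤a)))
      (≤-respʳ-≈ (sym (proj₂ (√-isSquareRoot (≤-trans 0≤a a≤b)))) a≤b))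

  -- Both nested folds in `diam` are instances of this by definition, so its bounds apply to `diam`
  -- directly.
  maximum : ∀ {A : Set} {m} → (A → ℝ) → Vector A m → ℝ
  maximum g = foldr (λ x D → g x ⊔ D) 0#

  ≤-maximum : ∀ {A : Set} {m} (g : A → ℝ) (V : Vector A m) i → g (V i) ≤ maximum g V
  ≤-maximum g V zero    = x≤x⊔y _ _
  ≤-maximum g V (suc i) = ≤-trans (≤-maximum g (V ∘ suc) i) (x≤y⊔x _ _)

  maximum-≤ : ∀ {A : Set} {m} {b} (g : A → ℝ) (V : Vector A m) → 0# ≤ b →
    (∀ i → g (V i) ≤ b) → maximum g V ≤ b
  maximum-≤ {m = zero}  g V 0≤b g≤b = 0≤b
  maximum-≤ {m = suc m} g V 0≤b g≤b =
    ⊔-lub (g≤b zero) (maximum-≤ g (V ∘ suc) 0≤b (g≤b ∘ suc))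

  dist≤diam : ∀ {d m} (V : Vector (Point d) m) i j → dist (V i) (V j) ≤ diam V
  dist≤diam V i j = ≤-trans (≤-maximum (dist (V i)) V j)
    (≤-maximum (λ x → maximum (dist x) V) V i)

  diam-≤ : ∀ {d m b} (V : Vector (Point d) m) → 0# ≤ b →
    (∀ i j → dist (V i) (V j) ≤ b) → diam V ≤ b
  diam-≤ V 0≤b dist≤b = maximum-≤ (λ x → maximum (dist x) V) V 0≤b
    λ i → maximum-≤ (dist (V i)) V 0≤b (dist≤b i)

  -- Edges have length `diam V` and no pair is further apart, which supplies the bound on the
  -- distance of x and y. The diameter is non-zero because a and b are distinct points.
  no-two-apexes-diameterGraph : ∀ {m} (V : Vector (Point 3) m) → (∀ i j → V i ≋ V j → i ≡ j) →
    let infix 4 _~_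
        _~_ = Adj (diameterGraph V)
    in ∀ {a b c x y} → a ~ b → a ~ c → b ~ c → x ~ a → x ~ b → x ~ c → y ~ a → y ~ b → y ~ c → x ≡ y
  no-two-apexes-diameterGraph V injective {a} {b} {c} {x} {y} ab ac bc xa xb xc ya yb yc =
    injective x y (no-two-apexes (V a) (V b) (V c) (V x) (V y) 0<s
      (adj ab) (adj ac) (adj bc) (adj xa) (adj xb) (adj xc) (adj ya) (adj yb) (adj yc)
      (≤-respˡ-≈ (dist-squared (V x) (V y))
        (square-mono-≤ (√-nonNegative _) (dist≤diam V x y))))
    where
    s : ℝ
    s = diam V * diam V
    adj : ∀ {i j} → Adj (diameterGraph V) i j → distSq (V i) (V j) ≈ s
    adj {i} {j} (_ , d≈diam) = trans (sym (dist-squared (V i) (V j))) (*-cong d≈diam d≈diam)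
    0<s : 0# < s
    0<s = square-nonNegative (diam V) , λ 0≈s → proj₁ ab
      (injective a b (distSq≈0⇒≋ (V a) (V b) (trans (adj ab) (sym 0≈s))))

  -- The origin and the vectors e_j + e_k.
  tetrahedronℤ : Fin 4 → Fin 3 → ℤ
  tetrahedronℤ zero    k = + 0
  tetrahedronℤ (suc i) k = if does (i Fin.≟ k) then + 0 else + 1

  distSqℤ : (x y : Fin 3 → ℤ) → ℤ
  distSqℤ x y = sq 0F ℤ.+ (sq 1F ℤ.+ (sq 2F ℤ.+ + 0))
    where
    sq : Fin 3 → ℤ
    sq i = (x i ℤ.- y i) ℤ.* (x i ℤ.- y i)

  -- Integer coordinates let all pairs be checked by evaluation; 2 is the squared face diagonal of
  -- the unit cube.
  tetrahedronℤ-distSq : ∀ i j → i ≢ j → distSqℤ (tetrahedronℤ i) (tetrahedronℤ j) ≡ + 2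
  tetrahedronℤ-distSq = from-yes (all? λ i → all? λ j →
    ¬? (i Fin.≟ j) →-dec (distSqℤ (tetrahedronℤ i) (tetrahedronℤ j) ℤ.≟ + 2))

  tetrahedron : Vector (Point 3) 4
  tetrahedron i k = fromℤ (tetrahedronℤ i k)

  distSq-fromℤ : ∀ x y → distSq (fromℤ ∘ x) (fromℤ ∘ y) ≈ fromℤ (distSqℤ x y)
  distSq-fromℤ x y = sym (trans (fromℤ-+ (sq 0F) _) (+-cong (square 0F)
    (trans (fromℤ-+ (sq 1F) _) (+-cong (square 1F)
    (trans (fromℤ-+ (sq 2F) _) (+-congʳ (square 2F)))))))
    where
    sq : Fin 3 → ℤ
    sq i = (x i ℤ.- y i) ℤ.* (x i ℤ.- y i)
    difference : ∀ i → fromℤ (x i ℤ.- y i) ≈ fromℤ (x i) - fromℤ (y i)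
    difference i = trans (fromℤ-+ (x i) _) (+-congˡ (fromℤ-neg (y i)))
    square : ∀ i → fromℤ (sq i) ≈ (fromℤ (x i) - fromℤ (y i)) * (fromℤ (x i) - fromℤ (y i))
    square i = trans (fromℤ-* (x i ℤ.- y i) _) (*-cong (difference i) (difference i))

  tetrahedron-distSq : ∀ {i j} → i ≢ j → distSq (tetrahedron i) (tetrahedron j) ≈ 1# + 1#
  tetrahedron-distSq {i} {j} i≢j = trans (distSq-fromℤ (tetrahedronℤ i) (tetrahedronℤ j))
    (reflexive (≡.cong fromℤ (tetrahedronℤ-distSq i j i≢j)))

  tetrahedron-injective : ∀ i j → tetrahedron i ≋ tetrahedron j → i ≡ j
  tetrahedron-injective i j i≋j = decidable-stable (i Fin.≟ j) λ i≢j → proj₂ 0<2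
    (trans (sym (distSq-refl (tetrahedron j)))
      (trans (sum-cong-≋ λ k → *-cong (shift k) (shift k))
        (tetrahedron-distSq i≢j)))
    where
    open MonoidSum +-monoid using (sum-cong-≋)
    shift : ∀ k → tetrahedron j k - tetrahedron j k ≈ tetrahedron i k - tetrahedron j k
    shift k = +-congʳ (sym (i≋j k))

  tetrahedron-dist : ∀ {i j} → i ≢ j → dist (tetrahedron i) (tetrahedron j) ≈ √ (1# + 1#)
  tetrahedron-dist i≢j = √-cong (tetrahedron-distSq i≢j)

  tetrahedron-diam : diam tetrahedron ≈ √ (1# + 1#)
  tetrahedron-diam = antisym
    (diam-≤ tetrahedron (√-nonNegative _) dist≤√2)
    (≤-respˡ-≈ (tetrahedron-dist {0F} {1F} λ ()) (dist≤diam tetrahedron 0F 1F))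
    where
    dist≤√2 : ∀ i j → dist (tetrahedron i) (tetrahedron j) ≤ √ (1# + 1#)
    dist≤√2 i j with i Fin.≟ j
    ... | no  i≢j    = ≤-reflexive (tetrahedron-dist i≢j)
    ... | yes ≡.refl = √-mono-≤ (distSq-nonNegative (tetrahedron i) (tetrahedron i))
                         (≤-respˡ-≈ (sym (distSq-refl (tetrahedron i))) (proj₁ 0<2))

  K₄-isDiameterGraph : ∀ G → Vertex G ↔ Fin 4 → (∀ u v → u ≢ v → Adj G u v) → IsDiameterGraph 3 G
  K₄-isDiameterGraph G f complete = 4 , tetrahedron , tetrahedron-injective , f , λ u v → mk⇔
    (λ u~v → adjacent λ eq → SimpleGraph.irrefl G (Injection.injective (↔⇒↣ f) eq) u~v)
    (λ (fu≢fv , _) → complete u v (fu≢fv ∘ ≡.cong (Inverse.to f)))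
    where
    adjacent : ∀ {i j} → i ≢ j → i ≢ j × dist (tetrahedron i) (tetrahedron j) ≈ diam tetrahedron
    adjacent i≢j = i≢j , trans (tetrahedron-dist i≢j) (sym tetrahedron-diam)

-- Subsets as vertex sets, and colourings of graphs whose complement is a matching.

enumerate : ∀ {n} (W : Subset n) → Fin ∣ W ∣ ↔ ∃ (_∈ W)
enumerate W = mk↔ₛ′ (to W) (from W) (to∘from W) (from∘to W)
  where
  shift : ∀ {n s} {W : Subset n} → ∃ (_∈ W) → ∃ (_∈ s ∷ W)
  shift (i , i∈W) = suc i , there i∈W

  to : ∀ {n} (W : Subset n) → Fin ∣ W ∣ → ∃ (_∈ W)
  to (outside ∷ W) a       = shift (to W a)
  to (inside  ∷ W) zero    = zero , here
  to (inside  ∷ W) (suc a) = shift (to W a)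

  from : ∀ {n} (W : Subset n) → ∃ (_∈ W) → Fin ∣ W ∣
  from (outside ∷ W) (suc i , there i∈W) = from W (i , i∈W)
  from (inside  ∷ W) (zero  , here)      = zero
  from (inside  ∷ W) (suc i , there i∈W) = suc (from W (i , i∈W))

  to∘from : ∀ {n} (W : Subset n) v → to W (from W v) ≡ v
  to∘from (outside ∷ W) (suc i , there i∈W) = ≡.cong shift (to∘from W (i , i∈W))
  to∘from (inside  ∷ W) (zero  , here)      = ≡.refl
  to∘from (inside  ∷ W) (suc i , there i∈W) = ≡.cong shift (to∘from W (i , i∈W))

  from∘to : ∀ {n} (W : Subset n) a → from W (to W a) ≡ a
  from∘to (outside ∷ W) a       = from∘to W a
  from∘to (inside  ∷ W) zero    = ≡.refl
  from∘to (inside  ∷ W) (suc a) = ≡.cong suc (from∘to W a)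

member-injective : ∀ {n} {W : Subset n} {u v : ∃ (_∈ W)} → proj₁ u ≡ proj₁ v → u ≡ v
member-injective {u = i , p} {_ , q} ≡.refl = ≡.cong (i ,_) ([]=-irrelevant p q)

-- The complement has maximum degree at most one, phrased positively: one non-neighbour of u forces
-- adjacency to every third vertex.
HasMatchingComplement : SimpleGraph → Set
HasMatchingComplement G = ∀ {u v w} → u ≢ v → u ≢ w → v ≢ w → ¬ Adj G u v → Adj G u w

-- A path with centre i and two edges in the complement. Distinctness is explicit because
-- `¬ Edge G i i` always holds.
Cherry : ∀ {n} → LabelledGraph n → (i j k : Fin n) → Set
Cherry G i j k = (i ≢ j × i ≢ k × j ≢ k) × ¬ Edge G i j × ¬ Edge G i k

module Colourings (em : ExcludedMiddle 0ℓ) where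

  cherry-free⇒matchingComplement : ∀ {n} (G : LabelledGraph n) →
    (∀ i j k → ¬ Cherry G i j k) → ∀ W → HasMatchingComplement (G [ W ])
  cherry-free⇒matchingComplement G cherry-free W {u} {v} {w} u≢v u≢w v≢w u≁v =
    decidable-stable em λ u≁w →
      cherry-free _ _ _ ((distinct u≢v , distinct u≢w , distinct v≢w) , u≁v , u≁w)
    where
    distinct : ∀ {u v : ∃ (_∈ W)} → u ≢ v → proj₁ u ≢ proj₁ v
    distinct u≢v = u≢v ∘ member-injective

  complete⇒connected : ∀ G → Vertex G → (∀ u v → u ≢ v → Adj G u v) → Connected G
  complete⇒connected G w complete = w , path
    where
    path : ∀ u v → Star (Adj G) u v
    path u v with em {u ≡ v}
    ... | yes ≡.refl = Star.ε
    ... | no u≢v   = complete u v u≢v ◅ Star.ε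

  complete⇒chromaticNumber : ∀ {n} G → Vertex G ↔ Fin n → (∀ u v → u ≢ v → Adj G u v) →
    HasChromaticNumber G n
  complete⇒chromaticNumber G f complete =
    (Inverse.to f , λ u~v fu≡fv → SimpleGraph.irrefl G (Injection.injective (↔⇒↣ f) fu≡fv) u~v) ,
    λ j (c , proper) → injective⇒≤ {f = c ∘ Inverse.from f} λ {a} {b} eq →
      decidable-stable (a Fin.≟ b) λ a≢b →
        proper (complete _ _ (a≢b ∘ Injection.injective (↔⇒↣ (↔-sym f)))) eq

  module _ (G : SimpleGraph) {k : ℕ} (¬colourable : ¬ Colourable G k)
           (c : Vertex G → Fin (suc k)) (proper : ∀ {u v} → Adj G u v → c u ≢ c v) where

    all-colours-needed : ∀ (c′ : Vertex G → Fin (suc k)) →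
      (∀ {u v} → Adj G u v → c′ u ≢ c′ v) → ∀ i → ∃ λ v → c′ v ≡ i
    all-colours-needed c′ proper′ i = decidable-stable em λ unused →
      let i≢c′ = λ v i≡c′v → unused (v , ≡.sym i≡c′v)
      in ¬colourable ((λ v → punchOut (i≢c′ v)) ,
           λ u~v eq → proper′ u~v (punchOut-injective (i≢c′ _) (i≢c′ _) eq))

    -- If v and w are non-adjacent, their colour classes are {v} and {w}, and can be merged.
    distinct-colours⇒Adj : HasMatchingComplement G → ∀ {v w} → c v ≢ c w → Adj G v w
    distinct-colours⇒Adj matching {v} {w} cv≢cw = decidable-stable em λ v≁w →
      -- A second vertex u of the colour of v would be a second non-neighbour of v, beside w.
      let singleton : ∀ {v w} → ¬ Adj G v w → c v ≢ c w → ∀ u → c u ≡ c v → u ≡ v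
          singleton {v} {w} v≁w cv≢cw u cu≡cv = decidable-stable em λ u≢v →
            proper (matching (λ { ≡.refl → cv≢cw ≡.refl }) (≢-sym u≢v)
              (λ { ≡.refl → cv≢cw (≡.sym cu≡cv) }) v≁w) (≡.sym cu≡cv)
          -- An edge between the two classes could only join v and w themselves.
          crossing : ∀ {u u′} → Adj G u u′ → c u ≡ c v → c u′ ≢ c w
          crossing {u} {u′} u~u′ cu≡cv cu′≡cw = v≁w (≡.subst₂ (Adj G)
            (singleton v≁w cv≢cw u cu≡cv)
            (singleton (v≁w ∘ SimpleGraph.sym G) (≢-sym cv≢cw) u′ cu′≡cw) u~u′)
          -- The merged colouring is proper, yet it avoids the colour `c w`.
          (u , eq) = all-colours-needed (merge ∘ c) (merge-proper crossing) (c w)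
      in merge≢ (c u) eq
      where
      merge : Fin (suc k) → Fin (suc k)
      merge i with i Fin.≟ c w
      ... | yes _ = c v
      ... | no _  = i
      merge≢ : ∀ i → merge i ≢ c w
      merge≢ i eq with i Fin.≟ c w
      ... | yes _   = cv≢cw eq
      ... | no i≢cw = i≢cw eq
      merge-proper : (∀ {u u′} → Adj G u u′ → c u ≡ c v → c u′ ≢ c w) →
        ∀ {u u′} → Adj G u u′ → merge (c u) ≢ merge (c u′)
      merge-proper crossing {u} {u′} u~u′ eq with c u Fin.≟ c w | c u′ Fin.≟ c w
      ... | yes p | yes q = proper u~u′ (≡.trans p (≡.sym q))
      ... | yes p | no _  = crossing (SimpleGraph.sym G u~u′) (≡.sym eq) p
      ... | no _  | yes q = crossing u~u′ eq q
      ... | no _  | no _  = proper u~u′ eq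

-- The order of 4-chromatic diameter graphs, and cliques as examples.

module Subgraphs (em : ExcludedMiddle 0ℓ) (R : Reals) where

  open RandomDiameterGraphs em R using (diameterGraph; IsDiameterGraph)
  open DiameterGraphs em R
  open Colourings em

  same-colour⇒≡ : ∀ G → IsDiameterGraph 3 G → HasMatchingComplement G → ¬ Colourable G 3 →
    (c : Vertex G → Fin 4) → (∀ {u v} → Adj G u v → c u ≢ c v) → ∀ {x y} → c x ≡ c y → x ≡ y
  same-colour⇒≡ G (m , V , V-injective , f , edges) matching ¬3-colourable c proper {x} {y} cx≡cy =
    Injection.injective (↔⇒↣ f) (no-two-apexes-diameterGraph V V-injective
      (base 0F 1F λ ()) (base 0F 2F λ ()) (base 1F 2F λ ())
      (apex ≡.refl 0F) (apex ≡.refl 1F) (apex ≡.refl 2F)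
      (apex cx≡cy 0F) (apex cx≡cy 1F) (apex cx≡cy 2F))
    where
    adjacent : ∀ {u v} → c u ≢ c v → Adj (diameterGraph V) (Inverse.to f u) (Inverse.to f v)
    adjacent cu≢cv = Equivalence.to (edges _ _)
      (distinct-colours⇒Adj G ¬3-colourable c proper matching cu≢cv)
    -- `punchIn (c x)` enumerates the three colours other than that of x; their representatives form
    -- the triangle.
    representative : ∀ i → ∃ λ v → c v ≡ punchIn (c x) i
    representative i = all-colours-needed G ¬3-colourable c proper c proper (punchIn (c x) i)
    r : Fin 3 → Vertex G
    r i = proj₁ (representative i)
    base : ∀ i j → i ≢ j → Adj (diameterGraph V) (Inverse.to f (r i)) (Inverse.to f (r j))
    base i j i≢j = adjacent λ eq → i≢j (punchIn-injective (c x) i j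
      (≡.trans (≡.sym (proj₂ (representative i))) (≡.trans eq (proj₂ (representative j)))))
    apex : ∀ {z} → c x ≡ c z → ∀ i → Adj (diameterGraph V) (Inverse.to f z) (Inverse.to f (r i))
    apex cx≡cz i = adjacent λ eq → punchInᵢ≢i (c x) i
      (≡.trans (≡.sym (proj₂ (representative i))) (≡.trans (≡.sym eq) (≡.sym cx≡cz)))

  4-chromatic-diameterGraph-order : ∀ {n} (G : LabelledGraph n) → (∀ i j k → ¬ Cherry G i j k) →
    ∀ W → IsDiameterGraph 3 (G [ W ]) → HasChromaticNumber (G [ W ]) 4 → ∣ W ∣ ℕ.≤ 4
  4-chromatic-diameterGraph-order G cherry-free W isDiameter ((c , proper) , minimal) =
    ℕ.≮⇒≥ λ 4<∣W∣ →
      let f = enumerate W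
          (i , j , i<j , eq) = pigeonhole 4<∣W∣ (c ∘ Inverse.to f)
      in Fin.<⇒≢ i<j (Injection.injective (↔⇒↣ f)
           (same-colour⇒≡ (G [ W ]) isDiameter (cherry-free⇒matchingComplement G cherry-free W)
             (ℕ.<⇒≱ (ℕ.n<1+n 3) ∘ minimal 3) c proper eq))

  clique-subgraph : ∀ {n} (G : LabelledGraph n) W → (f : Fin 4 ↔ ∃ (_∈ W)) →
    (∀ a b → a ≢ b → Edge G (proj₁ (Inverse.to f a)) (proj₁ (Inverse.to f b))) →
    IsDiameterGraph 3 (G [ W ]) × HasChromaticNumber (G [ W ]) 4 × Connected (G [ W ])
  clique-subgraph G W f edges =
    K₄-isDiameterGraph (G [ W ]) (↔-sym f) complete ,
    complete⇒chromaticNumber (G [ W ]) (↔-sym f) complete ,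
    complete⇒connected (G [ W ]) (Inverse.to f 0F) complete
    where
    complete : ∀ u v → u ≢ v → Adj (G [ W ]) u v
    complete u v u≢v = ≡.subst₂ (Adj (G [ W ]))
      (Inverse.strictlyInverseˡ f u) (Inverse.strictlyInverseˡ f v)
      (edges (Inverse.from f u) (Inverse.from f v)
        (u≢v ∘ Injection.injective (↔⇒↣ (↔-sym f))))

-- Finite weighted sums, expectations and the union bound.

module Probability (em : ExcludedMiddle 0ℓ) (R : Reals) where

  open RealOperations em R hiding (zero)
  open RealProperties em R
  open RandomDiameterGraphs em R using (indicator)
  open IntegerRingSolver (Reals.commutativeRing R)
  open SetoidReasoning setoid

  ∑ : ∀ {A : Set} → (A → ℝ) → List A → ℝ
  ∑ f xs = List.foldr _+_ 0# (List.map f xs)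

  ∑-map : ∀ {A B : Set} (f : B → ℝ) (g : A → B) xs → ∑ f (List.map g xs) ≡ ∑ (f ∘ g) xs
  ∑-map f g xs = ≡.cong (List.foldr _+_ 0#) (≡.sym (map-∘ xs))

  ∑-++ : ∀ {A : Set} (f : A → ℝ) xs ys → ∑ f (xs ++ ys) ≈ ∑ f xs + ∑ f ys
  ∑-++ f []       ys = sym (+-identityˡ _)
  ∑-++ f (x ∷ xs) ys = trans (+-congˡ (∑-++ f xs ys)) (sym (+-assoc _ _ _))

  module _ {A : Set} where

    ∑-cong : ∀ {f g : A → ℝ} → (∀ x → f x ≈ g x) → ∀ xs → ∑ f xs ≈ ∑ g xs
    ∑-cong f≈g []       = refl
    ∑-cong f≈g (x ∷ xs) = +-cong (f≈g x) (∑-cong f≈g xs)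

    ∑-mono : ∀ {f g : A → ℝ} → (∀ x → f x ≤ g x) → ∀ xs → ∑ f xs ≤ ∑ g xs
    ∑-mono f≤g []       = ≤-refl
    ∑-mono f≤g (x ∷ xs) = +-mono-≤ (f≤g x) (∑-mono f≤g xs)

    ∑-+ : ∀ (f g : A → ℝ) xs → ∑ (λ x → f x + g x) xs ≈ ∑ f xs + ∑ g xs
    ∑-+ f g []       = sym (+-identityˡ 0#)
    ∑-+ f g (x ∷ xs) = trans (+-congˡ (∑-+ f g xs))
      (solve 4 (λ a b c d → a :+ b :+ (c :+ d) := a :+ c :+ (b :+ d))
        refl (f x) (g x) (∑ f xs) (∑ g xs))

    ∑-*ˡ : ∀ c (f : A → ℝ) xs → ∑ (λ x → c * f x) xs ≈ c * ∑ f xs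
    ∑-*ˡ c f []       = sym (zeroʳ c)
    ∑-*ˡ c f (x ∷ xs) = trans (+-congˡ (∑-*ˡ c f xs)) (sym (distribˡ c _ _))

    ∑-cartesianProductWith : ∀ {B C : Set} (f : C → ℝ) (_∙_ : A → B → C) xs ys →
      ∑ f (List.cartesianProductWith _∙_ xs ys) ≈ ∑ (λ x → ∑ (λ y → f (x ∙ y)) ys) xs
    ∑-cartesianProductWith f _∙_ []       ys = refl
    ∑-cartesianProductWith f _∙_ (x ∷ xs) ys = begin
      ∑ f (List.map (x ∙_) ys ++ List.cartesianProductWith _∙_ xs ys)
        ≈⟨ ∑-++ f (List.map (x ∙_) ys) _ ⟩
      ∑ f (List.map (x ∙_) ys) + ∑ f (List.cartesianProductWith _∙_ xs ys)
        ≈⟨ +-cong (reflexive (∑-map f (x ∙_) ys)) (∑-cartesianProductWith f _∙_ xs ys) ⟩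
      ∑ (λ y → f (x ∙ y)) ys + ∑ (λ x → ∑ (λ y → f (x ∙ y)) ys) xs ∎

  indicator-true : ∀ {A} → A → indicator A ≈ 1#
  indicator-true {A} a with em {A}
  ... | yes _ = refl
  ... | no ¬a = contradiction a ¬a

  indicator-false : ∀ {A} → ¬ A → indicator A ≈ 0#
  indicator-false {A} ¬a with em {A}
  ... | yes a = contradiction a ¬a
  ... | no _  = refl

  indicator-nonNegative : ∀ A → 0# ≤ indicator A
  indicator-nonNegative A with em {A}
  ... | yes _ = 0≤1
  ... | no _  = ≤-refl

  indicator-≤1 : ∀ A → indicator A ≤ 1#
  indicator-≤1 A with em {A}
  ... | yes _ = ≤-refl
  ... | no _  = 0≤1

  indicator-≤ : ∀ {A x} → 0# ≤ x → (A → 1# ≤ x) → indicator A ≤ x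
  indicator-≤ {A} 0≤x 1≤x with em {A}
  ... | yes a = 1≤x a
  ... | no _  = 0≤x

  indicator-mono : ∀ {A B} → (A → B) → indicator A ≤ indicator B
  indicator-mono {A} {B} f = indicator-≤ (indicator-nonNegative B)
    λ a → ≤-reflexive (sym (indicator-true (f a)))

  indicator-× : ∀ A B → indicator (A × B) ≤ indicator A * indicator B
  indicator-× A B = indicator-≤
    (*-nonNegative (indicator-nonNegative A) (indicator-nonNegative B))
    λ (a , b) → ≤-reflexive (sym
      (trans (*-cong (indicator-true a) (indicator-true b)) (*-identityˡ 1#)))

  indicator-⊎ : ∀ A B → indicator (A ⊎ B) ≤ indicator A + indicator B
  indicator-⊎ A B = indicator-≤
    (+-nonNegative (indicator-nonNegative A) (indicator-nonNegative B)) λ where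
      (inj₁ a) → ≤-respˡ-≈ (+-identityʳ 1#)
        (+-mono-≤ (≤-reflexive (sym (indicator-true a))) (indicator-nonNegative B))
      (inj₂ b) → ≤-respˡ-≈ (+-identityˡ 1#)
        (+-mono-≤ (indicator-nonNegative A) (≤-reflexive (sym (indicator-true b))))

  -- Serves two sample spaces: subsets, as neighbourhoods of the vertex zero, and labelled graphs.
  module Expectation {A : Set} (w : A → ℝ) (xs : List A) (0≤w : ∀ x → 0# ≤ w x) where

    𝔼 : (A → ℝ) → ℝ
    𝔼 f = ∑ (λ x → w x * f x) xs

    ℙ : Pred A 0ℓ → ℝ
    ℙ B = 𝔼 (λ x → indicator (B x))

    𝔼-mono : ∀ {f g : A → ℝ} → (∀ x → f x ≤ g x) → 𝔼 f ≤ 𝔼 g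
    𝔼-mono f≤g = ∑-mono (λ x → *-monoˡ-≤ (0≤w x) (f≤g x)) xs

    𝔼-+ : ∀ f g → 𝔼 (λ x → f x + g x) ≈ 𝔼 f + 𝔼 g
    𝔼-+ f g = trans (∑-cong (λ x → distribˡ (w x) (f x) (g x)) xs) (∑-+ _ _ xs)

    𝔼-*ˡ : ∀ c f → 𝔼 (λ x → c * f x) ≈ c * 𝔼 f
    𝔼-*ˡ c f = trans
      (∑-cong (λ x → solve 3 (λ w c f → w :* (c :* f) := c :* (w :* f)) refl (w x) c (f x)) xs)
      (∑-*ˡ c _ xs)

    𝔼-*ʳ : ∀ c f → 𝔼 (λ x → f x * c) ≈ 𝔼 f * c
    𝔼-*ʳ c f = trans (∑-cong (λ x → *-congˡ (*-comm (f x) c)) xs) (trans (𝔼-*ˡ c f) (*-comm c _))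

    𝔼-zero : 𝔼 (const 0#) ≈ 0#
    𝔼-zero = trans (∑-cong (λ x → trans (zeroʳ (w x)) (sym (zeroˡ (w x)))) xs)
      (trans (∑-*ˡ 0# w xs) (zeroˡ _))

    ℙ-mono : ∀ {B C : Pred A 0ℓ} → (∀ {x} → B x → C x) → ℙ B ≤ ℙ C
    ℙ-mono B⊆C = 𝔼-mono λ x → indicator-mono B⊆C

    ℙ-empty : ∀ {B : Pred A 0ℓ} → (∀ {x} → ¬ B x) → ℙ B ≤ 0#
    ℙ-empty ¬B = ≤-respʳ-≈ 𝔼-zero (𝔼-mono λ x → ≤-reflexive (indicator-false ¬B))

    ℙ-⊎ : ∀ (B C : Pred A 0ℓ) → ℙ (λ x → B x ⊎ C x) ≤ ℙ B + ℙ C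
    ℙ-⊎ B C = ≤-respʳ-≈ (𝔼-+ _ _) (𝔼-mono λ x → indicator-⊎ (B x) (C x))

    -- The bound b is uniform in i, so nested existential quantifiers over vertices cost one factor
    -- `fromℕ n` each.
    union-bound : ∀ {n b} (B : Fin n → Pred A 0ℓ) → (∀ i → ℙ (B i) ≤ b) →
      ℙ (λ x → ∃ λ i → B i x) ≤ fromℕ n * b
    union-bound {zero}  {b} B B≤b = ≤-respʳ-≈ (sym (zeroˡ b)) (ℙ-empty λ ())
    union-bound {suc n} {b} B B≤b = ≤-trans
      (ℙ-mono λ { (zero , b) → inj₁ b ; (suc i , b) → inj₂ (i , b) })
      (≤-trans (ℙ-⊎ (B zero) (λ x → ∃ λ i → B (suc i) x))
        (≤-respʳ-≈ (solve 2 (λ n b → b :+ n :* b := (con (+ 1) :+ n) :* b) refl (fromℕ n) b)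
          (+-mono-≤ (B≤b zero) (union-bound (B ∘ suc) (B≤b ∘ suc)))))

    module _ (total-mass : 𝔼 (const 1#) ≈ 1#) where

      𝔼-const : ∀ c → 𝔼 (const c) ≈ c
      𝔼-const c = trans (∑-cong (λ x → *-congˡ (sym (*-identityʳ c))) xs)
        (trans (𝔼-*ˡ c (const 1#)) (trans (*-congˡ total-mass) (*-identityʳ c)))

      ℙ-≤1 : ∀ B → ℙ B ≤ 1#
      ℙ-≤1 B = ≤-respʳ-≈ total-mass (𝔼-mono λ x → indicator-≤1 (B x))

      ℙ-∁ : ∀ B → 1# ≤ ℙ B + ℙ (∁ B)
      ℙ-∁ B = ≤-respˡ-≈ total-mass (≤-trans
        (𝔼-mono λ x → ≤-reflexive (sym (indicator-true {B x ⊎ ∁ B x} (excluded x))))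
        (ℙ-⊎ B (∁ B)))
        where
        excluded : ∀ x → B x ⊎ ∁ B x
        excluded x with em {B x}
        ... | yes b = inj₁ b
        ... | no ¬b = inj₂ ¬b

-- Probabilities of non-edges in the random graph.

module RandomGraphs (em : ExcludedMiddle 0ℓ) (R : Reals) where

  open RealOperations em R hiding (zero)
  open RealProperties em R
  open RandomDiameterGraphs em R using (indicator; subsetWeight; weight; ℙ[_,_])
  open Probability em R
  open IntegerRingSolver (Reals.commutativeRing R)
  open SetoidReasoning setoid

  module _ (p : ℝ) (0≤p : 0# ≤ p) (p≤1 : p ≤ 1#) where

    q : ℝ
    q = 1# - p

    0≤q : 0# ≤ q
    0≤q = x≤y⇒0≤y-x p≤1

    subsetWeight-nonNegative : ∀ {n} (N : Subset n) → 0# ≤ subsetWeight p N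
    subsetWeight-nonNegative []            = 0≤1
    subsetWeight-nonNegative (inside  ∷ N) = *-nonNegative 0≤p (subsetWeight-nonNegative N)
    subsetWeight-nonNegative (outside ∷ N) = *-nonNegative 0≤q (subsetWeight-nonNegative N)

    weight-nonNegative : ∀ {n} (G : LabelledGraph n) → 0# ≤ weight p G
    weight-nonNegative []      = 0≤1
    weight-nonNegative (N ∷ G) = *-nonNegative (subsetWeight-nonNegative N) (weight-nonNegative G)

    module Subsets (n : ℕ) =
      Expectation (subsetWeight {n} p) (allSubsets n) subsetWeight-nonNegative
    module Graphs (n : ℕ) =
      Expectation (weight {n} p) (allGraphs n) weight-nonNegative
    open Subsets using () renaming (𝔼 to 𝔼ₛ; ℙ to ℙₛ)
    open Graphs using () renaming (𝔼 to 𝔼ᵍ; ℙ to ℙᵍ)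

    𝔼ₛ-suc : ∀ {n} f → 𝔼ₛ (suc n) f ≈ q * 𝔼ₛ n (f ∘ (outside ∷_)) + p * 𝔼ₛ n (f ∘ (inside ∷_))
    𝔼ₛ-suc {n} f = trans (∑-++ _ (List.map (outside ∷_) (allSubsets n)) _)
      (+-cong (branch outside q λ _ → refl) (branch inside p λ _ → refl))
      where
      branch : ∀ s c → (∀ N → subsetWeight p (s ∷ N) ≈ c * subsetWeight p N) →
        ∑ (λ N → subsetWeight p N * f N) (List.map (s ∷_) (allSubsets n)) ≈ c * 𝔼ₛ n (f ∘ (s ∷_))
      branch s c eq = begin
        _ ≡⟨ ∑-map _ (s ∷_) (allSubsets n) ⟩
        _ ≈⟨ ∑-cong (λ N → trans (*-congʳ (eq N)) (*-assoc c _ _)) (allSubsets n) ⟩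
        _ ≈⟨ ∑-*ˡ c _ (allSubsets n) ⟩
        _ ∎

    -- Conditions on the neighbourhood N of the vertex zero, whose weight is a separate factor. With
    -- `𝔼ₛ-suc` this is how independence of the edges enters.
    𝔼ᵍ-suc : ∀ {n} f → 𝔼ᵍ (suc n) f ≈ 𝔼ₛ n (λ N → 𝔼ᵍ n (λ G → f (N ∷ G)))
    𝔼ᵍ-suc {n} f = trans (∑-cartesianProductWith _ _∷_ (allSubsets n) (allGraphs n))
      (∑-cong (λ N → trans (∑-cong (λ G → *-assoc _ _ _) (allGraphs n)) (∑-*ˡ _ _ (allGraphs n)))
        (allSubsets n))

    q-p-average : ∀ {x y b} → x ≤ b → y ≤ b → q * x + p * y ≤ b
    q-p-average {b = b} x≤b y≤b = ≤-respʳ-≈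
      (solve 2 (λ p b → (con (+ 1) :- p) :* b :+ p :* b := b) refl p b)
      (+-mono-≤ (*-monoˡ-≤ 0≤q x≤b) (*-monoˡ-≤ 0≤p y≤b))

    𝔼ₛ-total : ∀ n → 𝔼ₛ n (const 1#) ≈ 1#
    𝔼ₛ-total zero    = solve 0 (con (+ 1) :* con (+ 1) :+ con (+ 0) := con (+ 1)) refl
    𝔼ₛ-total (suc n) = trans (𝔼ₛ-suc {n} (const 1#)) (trans
      (+-cong (*-congˡ (𝔼ₛ-total n)) (*-congˡ (𝔼ₛ-total n)))
      (solve 1 (λ p → (con (+ 1) :- p) :* con (+ 1) :+ p :* con (+ 1) := con (+ 1)) refl p))

    𝔼ᵍ-total : ∀ n → 𝔼ᵍ n (const 1#) ≈ 1#
    𝔼ᵍ-total zero    = solve 0 (con (+ 1) :* con (+ 1) :+ con (+ 0) := con (+ 1)) refl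
    𝔼ᵍ-total (suc n) = trans (𝔼ᵍ-suc {n} (const 1#)) (trans
      (∑-cong (λ N → *-congˡ (𝔼ᵍ-total n)) (allSubsets n)) (𝔼ₛ-total n))

    -- Only the branch without zero contributes, and it carries the factor q.
    ℙₛ-zero∉ : ∀ {n b} (B : Pred (Subset (suc n)) 0ℓ) → (∀ {N} → B N → zero ∉ N) →
      ℙₛ n (B ∘ (outside ∷_)) ≤ b → ℙₛ (suc n) B ≤ q * b
    ℙₛ-zero∉ {n} {b} B zero∉ B≤b = ≤-respˡ-≈ (sym (𝔼ₛ-suc {n} _)) (≤-respʳ-≈
      (trans (+-congˡ (zeroʳ p)) (+-identityʳ _))
      (+-mono-≤ (*-monoˡ-≤ 0≤q B≤b)
        (*-monoˡ-≤ 0≤p (Subsets.ℙ-empty n {B ∘ (inside ∷_)} λ b → zero∉ b here))))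

    ℙₛ-∉ : ∀ {n} (i : Fin n) → ℙₛ n (i ∉_) ≤ q
    ℙₛ-∉ {suc n} zero = ≤-respʳ-≈ (*-identityʳ q)
      (ℙₛ-zero∉ {n} (zero ∉_) id (Subsets.ℙ-≤1 n (𝔼ₛ-total n) _))
    ℙₛ-∉ {suc n} (suc i) =
      ≤-respˡ-≈ (sym (𝔼ₛ-suc {n} _)) (q-p-average (step {outside}) (step {inside}))
      where
      step : ∀ {s} → ℙₛ n (λ N → suc i ∉ s ∷ N) ≤ q
      step = ≤-trans (Subsets.ℙ-mono n (_∘ there)) (ℙₛ-∉ i)

    ℙₛ-∉∉ : ∀ {n} (i j : Fin n) → i ≢ j → ℙₛ n (λ N → i ∉ N × j ∉ N) ≤ q * q
    ℙₛ-∉∉ zero zero i≢j = contradiction ≡.refl i≢j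
    ℙₛ-∉∉ {suc n} zero (suc j) i≢j = ℙₛ-zero∉ {n} _ proj₁
      (≤-trans (Subsets.ℙ-mono n λ (_ , j∉) → j∉ ∘ there) (ℙₛ-∉ j))
    ℙₛ-∉∉ {suc n} (suc i) zero i≢j = ℙₛ-zero∉ {n} _ proj₂
      (≤-trans (Subsets.ℙ-mono n λ (i∉ , _) → i∉ ∘ there) (ℙₛ-∉ i))
    ℙₛ-∉∉ {suc n} (suc i) (suc j) i≢j =
      ≤-respˡ-≈ (sym (𝔼ₛ-suc {n} _)) (q-p-average (step {outside}) (step {inside}))
      where
      step : ∀ {s} → ℙₛ n (λ N → suc i ∉ s ∷ N × suc j ∉ s ∷ N) ≤ q * q
      step = ≤-trans (Subsets.ℙ-mono n λ (i∉ , j∉) → i∉ ∘ there , j∉ ∘ there)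
        (ℙₛ-∉∉ i j (i≢j ∘ ≡.cong suc))

    𝔼ᵍ-suc-≤ : ∀ {n f} g → (∀ N → 𝔼ᵍ n (λ G → f (N ∷ G)) ≤ g N) → 𝔼ᵍ (suc n) f ≤ 𝔼ₛ n g
    𝔼ᵍ-suc-≤ {n} g f≤g = ≤-respˡ-≈ (sym (𝔼ᵍ-suc {n} _)) (Subsets.𝔼-mono n f≤g)

    𝔼ᵍ-const-≤ : ∀ n c → 𝔼ᵍ n (const c) ≤ c
    𝔼ᵍ-const-≤ n c = ≤-reflexive (Graphs.𝔼-const n (𝔼ᵍ-total n) c)

    𝔼ₛ-const-≤ : ∀ n c → 𝔼ₛ n (const c) ≤ c
    𝔼ₛ-const-≤ n c = ≤-reflexive (Subsets.𝔼-const n (𝔼ₛ-total n) c)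

    ℙᵍ-nonEdge : ∀ {n} (i j : Fin n) → i ≢ j → ℙᵍ n (λ G → ¬ Edge G i j) ≤ q
    ℙᵍ-nonEdge zero zero i≢j = contradiction ≡.refl i≢j
    ℙᵍ-nonEdge {suc n} zero (suc j) _ =
      ≤-trans (𝔼ᵍ-suc-≤ {n} _ λ N → 𝔼ᵍ-const-≤ n _) (ℙₛ-∉ j)
    ℙᵍ-nonEdge {suc n} (suc i) zero _ =
      ≤-trans (𝔼ᵍ-suc-≤ {n} _ λ N → 𝔼ᵍ-const-≤ n _) (ℙₛ-∉ i)
    ℙᵍ-nonEdge {suc n} (suc i) (suc j) i≢j =
      ≤-trans (𝔼ᵍ-suc-≤ {n} (const q) λ N → ℙᵍ-nonEdge i j (i≢j ∘ ≡.cong suc)) (𝔼ₛ-const-≤ n q)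

    -- If the centre i is zero, both non-edges are read off one neighbourhood. If an end is zero,
    -- one non-edge lies in the neighbourhood and the other in the remaining graph. Otherwise zero
    -- is dropped.
    ℙᵍ-nonEdges : ∀ {n} (i j k : Fin n) → i ≢ j → i ≢ k → j ≢ k →
      ℙᵍ n (λ G → ¬ Edge G i j × ¬ Edge G i k) ≤ q * q
    ℙᵍ-nonEdges zero zero _ i≢j _ _ = contradiction ≡.refl i≢j
    ℙᵍ-nonEdges zero (suc _) zero _ i≢k _ = contradiction ≡.refl i≢k
    ℙᵍ-nonEdges (suc _) zero zero _ _ j≢k = contradiction ≡.refl j≢k
    ℙᵍ-nonEdges {suc n} zero (suc j) (suc k) _ _ j≢k =
      ≤-trans (𝔼ᵍ-suc-≤ {n} _ λ N → 𝔼ᵍ-const-≤ n _) (ℙₛ-∉∉ j k (j≢k ∘ ≡.cong suc))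
    ℙᵍ-nonEdges {suc n} (suc i) zero (suc k) _ i≢k _ = ≤-trans
      -- For fixed N the first condition is a constant, so its indicator is pulled out and q bounds
      -- the rest.
      (𝔼ᵍ-suc-≤ {n} (λ N → indicator (i ∉ N) * q) λ N →
        ≤-trans (Graphs.𝔼-mono n λ G → indicator-× (i ∉ N) (¬ Edge G i k))
          (≤-respˡ-≈ (sym (Graphs.𝔼-*ˡ n _ _))
            (*-monoˡ-≤ (indicator-nonNegative (i ∉ N)) (ℙᵍ-nonEdge i k (i≢k ∘ ≡.cong suc)))))
      (≤-respˡ-≈ (sym (Subsets.𝔼-*ʳ n q _)) (*-monoʳ-≤ 0≤q (ℙₛ-∉ i)))
    ℙᵍ-nonEdges {suc n} (suc i) (suc j) zero i≢j i≢k j≢k = ≤-trans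
      (Graphs.ℙ-mono (suc n) {λ G → ¬ Edge G (suc i) (suc j) × ¬ Edge G (suc i) zero} swap)
      (ℙᵍ-nonEdges (suc i) zero (suc j) i≢k i≢j (j≢k ∘ ≡.sym))
    ℙᵍ-nonEdges {suc n} (suc i) (suc j) (suc k) i≢j i≢k j≢k = ≤-trans
      (𝔼ᵍ-suc-≤ {n} (const (q * q)) λ N → ℙᵍ-nonEdges i j k
        (i≢j ∘ ≡.cong suc) (i≢k ∘ ≡.cong suc) (j≢k ∘ ≡.cong suc))
      (𝔼ₛ-const-≤ n (q * q))

    ℙᵍ-cherry : ∀ {n} (i j k : Fin n) → ℙᵍ n (λ G → Cherry G i j k) ≤ q * q
    ℙᵍ-cherry {n} i j k with em {i ≢ j × i ≢ k × j ≢ k}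
    ... | yes (i≢j , i≢k , j≢k) =
          ≤-trans (Graphs.ℙ-mono n proj₂) (ℙᵍ-nonEdges i j k i≢j i≢k j≢k)
    ... | no ¬distinct =
          ≤-trans (Graphs.ℙ-empty n λ (distinct , _) → ¬distinct distinct) (square-nonNegative q)

    ℙ-cherries : ∀ n → ℙ[ n , p ] (λ G → ∃ λ i → ∃ λ j → ∃ λ k → Cherry G i j k) ≤
      fromℕ n * (fromℕ n * (fromℕ n * (q * q)))
    ℙ-cherries n = Graphs.union-bound n _ λ i → Graphs.union-bound n _ λ j →
      Graphs.union-bound n _ λ k → ℙᵍ-cherry i j k

    -- The union runs over all k² ordered pairs, with empty events on the diagonal; for k = 4 this
    -- is the factor 16.
    ℙ-notClique : ∀ {n k} (v : Fin k → Fin n) → (∀ {a b} → v a ≡ v b → a ≡ b) →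
      ℙ[ n , p ] (λ G → ∃ λ a → ∃ λ b → a ≢ b × ¬ Edge G (v a) (v b)) ≤ fromℕ k * (fromℕ k * q)
    ℙ-notClique {n} v v-injective =
      Graphs.union-bound n _ λ a → Graphs.union-bound n _ λ b → bound a b
      where
      bound : ∀ a b → ℙᵍ n (λ G → a ≢ b × ¬ Edge G (v a) (v b)) ≤ q
      bound a b with em {a ≡ b}
      ... | yes a≡b = ≤-trans (Graphs.ℙ-empty n λ (a≢b , _) → a≢b a≡b) 0≤q
      ... | no a≢b  = ≤-trans (Graphs.ℙ-mono n proj₂) (ℙᵍ-nonEdge (v a) (v b) (a≢b ∘ v-injective))

    ℙ-mono : ∀ n {B C : Pred (LabelledGraph n) 0ℓ} → (∀ {G} → B G → C G) →
      ℙ[ n , p ] B ≤ ℙ[ n , p ] C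
    ℙ-mono n = Graphs.ℙ-mono n

    ℙ-complement : ∀ {n} (B : Pred (LabelledGraph n) 0ℓ) → 1# ≤ ℙ[ n , p ] B + ℙ[ n , p ] (∁ B)
    ℙ-complement {n} = Graphs.ℙ-∁ n (𝔼ᵍ-total n)

-- Four fixed vertices, numerical thresholds and the final estimate.

subset-of-size : ∀ {k n} → k ℕ.≤ n → ∃ λ (W : Subset n) → ∣ W ∣ ≡ k
subset-of-size {n = n} ℕ.z≤n = ⊥ , ∣⊥∣≡0 n
subset-of-size (ℕ.s≤s k≤n) =
  let W , ∣W∣≡k = subset-of-size k≤n in inside ∷ W , ≡.cong suc ∣W∣≡k

module Asymptotics (em : ExcludedMiddle 0ℓ) (R : Reals) where

  open RealOperations em R hiding (zero)
  open RandomDiameterGraphs em R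
  open RealProperties em R
  open RandomGraphs em R hiding (q; 0≤q)
  open Subgraphs em R
  open IntegerRingSolver (Reals.commutativeRing R)

  fromℕ-nonNegative : ∀ n → 0# ≤ fromℕ n
  fromℕ-nonNegative zero    = ≤-refl
  fromℕ-nonNegative (suc n) = +-nonNegative 0≤1 (fromℕ-nonNegative n)

  1≤fromℕ-suc : ∀ n → 1# ≤ fromℕ (suc n)
  1≤fromℕ-suc n = ≤-respˡ-≈ (+-identityʳ 1#) (+-mono-≤ ≤-refl (fromℕ-nonNegative n))

  *-≥1 : ∀ {x y} → 1# ≤ x → 1# ≤ y → 1# ≤ x * y
  *-≥1 {x} 1≤x 1≤y = ≤-trans 1≤x
    (≤-respˡ-≈ (*-identityʳ x) (*-monoˡ-≤ (≤-trans 0≤1 1≤x) 1≤y))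

  √fromℕ-squared : ∀ n → √ (fromℕ n) * √ (fromℕ n) ≈ fromℕ n
  √fromℕ-squared n = proj₂ (√-isSquareRoot (fromℕ-nonNegative n))

  1≤n^1·5 : ∀ {n} → 1 ℕ.≤ n → 1# ≤ n ^1·5
  1≤n^1·5 {suc n} _ = *-≥1 (1≤fromℕ-suc n) (square-cancel-≤ (√-nonNegative _)
    (≤-respˡ-≈ (sym (*-identityˡ 1#))
      (≤-respʳ-≈ (sym (√fromℕ-squared (suc n))) (1≤fromℕ-suc n))))

  n^1·5-squared : ∀ n → n ^1·5 * n ^1·5 ≈ fromℕ n * (fromℕ n * fromℕ n)
  n^1·5-squared n = trans
    (solve 2 (λ n r → n :* r :* (n :* r) := n :* (n :* (r :* r))) refl (fromℕ n) (√ (fromℕ n)))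
    (*-congˡ (*-congˡ (√fromℕ-squared n)))

  -- Undoes the division in the little-o hypothesis; `1# ≤ t` guarantees that `t ⁻¹` is a true
  -- inverse and not the default 0.
  ≤-inverse⇒*-≤ : ∀ {q ε t} → 0# ≤ q → 1# ≤ t → abs q ≤ ε * abs (t ⁻¹) → q * t ≤ ε
  ≤-inverse⇒*-≤ {q} {ε} {t} 0≤q 1≤t ∣q∣≤ε∣t⁻¹∣ = ≤-respʳ-≈
    (trans (*-congʳ (*-congˡ (abs-nonNegative 0≤t⁻¹)))
      (trans (solve 3 (λ ε s t → ε :* s :* t := t :* s :* ε) refl ε (t ⁻¹) t)
        (trans (*-congʳ tt⁻¹≈1) (*-identityˡ ε))))
    (*-monoʳ-≤ (proj₁ 0<t) (≤-respˡ-≈ (abs-nonNegative 0≤q) ∣q∣≤ε∣t⁻¹∣))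
    where
    0<t : 0# < t
    0<t = <-≤-trans 0<1 1≤t
    tt⁻¹≈1 : t * t ⁻¹ ≈ 1#
    tt⁻¹≈1 = *-inverseʳ λ t≈0 → proj₂ 0<t (sym t≈0)
    0≤t⁻¹ : 0# ≤ t ⁻¹
    0≤t⁻¹ = *-cancelˡ-nonNegative 0<t (≤-respʳ-≈ (sym tt⁻¹≈1) 0≤1)

  module _ {n : ℕ} {p : ℝ} (0≤p : 0# ≤ p) (p≤1 : p ≤ 1#) where

    -- The predicate `P` stands for the conditions on W, with or without connectedness, so that u
    -- and u′ share one proof. Such a W forces a cherry in G.
    ℙ-order>4 : ∀ {k} (P : LabelledGraph n → Subset n → Set) → 4 ℕ.< k →
      (∀ {G W} → P G W → IsDiameterGraph 3 (G [ W ]) × HasChromaticNumber (G [ W ]) 4) →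
      ℙ[ n , p ] (λ G → ∃ λ W → ∣ W ∣ ≡ k × P G W) ≤
        fromℕ n * (fromℕ n * (fromℕ n * ((1# - p) * (1# - p))))
    ℙ-order>4 P 4<k P⇒ = ≤-trans
      (ℙ-mono p 0≤p p≤1 n λ { {G} (W , ≡.refl , PGW) → decidable-stable em λ cherry-free →
        let isDiameter , χ≡4 = P⇒ PGW
        in ℕ.<⇒≱ 4<k (4-chromatic-diameterGraph-order G
             (λ i j k cherry → cherry-free (i , j , k , cherry)) W isDiameter χ≡4) })
      (ℙ-cherries p 0≤p p≤1 n)

    -- The witness W is chosen independently of G, so failure means that one of its pairs is a
    -- non-edge.
    ℙ-order≡4 : 4 ℕ.≤ n → ∀ (P : LabelledGraph n → Subset n → Set) →
      (∀ {G W} → IsDiameterGraph 3 (G [ W ]) × HasChromaticNumber (G [ W ]) 4 × Connected (G [ W ])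
        → P G W) →
      1# ≤ ℙ[ n , p ] (λ G → ∃ λ W → ∣ W ∣ ≡ 4 × P G W) + fromℕ 4 * (fromℕ 4 * (1# - p))
    ℙ-order≡4 4≤n P ⇒P = ≤-trans (ℙ-complement p 0≤p p≤1 Clique) (+-mono-≤
      (ℙ-mono p 0≤p p≤1 n λ {G} clique → W , ∣W∣≡4 , ⇒P (clique-subgraph G W f clique))
      (≤-trans
        (ℙ-mono p 0≤p p≤1 n λ ¬clique → decidable-stable em λ none →
          ¬clique λ a b a≢b → decidable-stable em λ ¬edge → none (a , b , a≢b , ¬edge))
        (ℙ-notClique p 0≤p p≤1 v (Injection.injective (↔⇒↣ f) ∘ member-injective))))
      where
      W : Subset n
      W = proj₁ (subset-of-size 4≤n)
      ∣W∣≡4 : ∣ W ∣ ≡ 4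
      ∣W∣≡4 = proj₂ (subset-of-size 4≤n)
      f : Fin 4 ↔ ∃ (_∈ W)
      f = ≡.subst (λ k → Fin k ↔ ∃ (_∈ W)) ∣W∣≡4 (enumerate W)
      v : Fin 4 → Fin n
      v a = proj₁ (Inverse.to f a)
      Clique : LabelledGraph n → Set
      Clique G = ∀ a b → a ≢ b → Edge G (v a) (v b)

  -- The value 1/64 makes 16ε = 1/4 < ½, and also ε² ≤ ½. As a product of halves it cancels against
  -- powers of ½ + ½ = 1.
  ε : ℝ
  ε = ½ * ½ * (½ * ½) * (½ * ½)

  0<ε : 0# < ε
  0<ε = *-positive (*-positive 0<¼ 0<¼) 0<¼
    where
    0<¼ : 0# < ½ * ½
    0<¼ = *-positive 0<½ 0<½

  16ε≈¼ : fromℕ 4 * (fromℕ 4 * ε) ≈ ½ * ½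
  16ε≈¼ = trans
    -- The shape of `4#` is that of `fromℕ 4`, which ends in `0#`, unlike `con (+ 4)`.
    (solve 1 (λ h → let 4# = con (+ 1) :+ (con (+ 1) :+ (con (+ 1) :+ (con (+ 1) :+ con (+ 0)))) in
       4# :* (4# :* (h :* h :* (h :* h) :* (h :* h)))
       := (h :+ h) :* (h :+ h) :* ((h :+ h) :* (h :+ h)) :* (h :* h)) refl ½)
    (trans (*-congʳ (*-cong (*-cong ½+½≈1 ½+½≈1) (*-cong ½+½≈1 ½+½≈1)))
      (solve 1 (λ x → con (+ 1) :* con (+ 1) :* (con (+ 1) :* con (+ 1)) :* x := x) refl (½ * ½)))

  ¼<½ : ½ * ½ < ½
  ¼<½ = <-by-difference (*-positive 0<½ 0<½)
    (trans (+-congʳ (trans (sym (*-identityˡ ½)) (*-congʳ (sym ½+½≈1))))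
      (solve 1 (λ h → (h :+ h) :* h :- h :* h := h :* h) refl ½))

  ½≤1 : ½ ≤ 1#
  ½≤1 = ≤-by-difference (proj₁ 0<½)
    (trans (+-congʳ (sym ½+½≈1)) (solve 1 (λ h → h :+ h :- h := h) refl ½))

  ε≤½ : ε ≤ ½
  ε≤½ = ≤-trans (≤-trans
    (≤-respˡ-≈ (*-identityˡ ε) (*-monoʳ-≤ (proj₁ 0<ε) (*-≥1 (1≤fromℕ-suc 3) (1≤fromℕ-suc 3))))
    (≤-reflexive (trans (*-assoc _ _ _) 16ε≈¼))) (proj₁ ¼<½)

  εε≤½ : ε * ε ≤ ½
  εε≤½ = ≤-trans (≤-respʳ-≈ (*-identityʳ ε) (*-monoˡ-≤ (proj₁ 0<ε) (≤-trans ε≤½ ½≤1))) ε≤½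

  module _ {n : ℕ} (4≤n : 4 ℕ.≤ n) {p : ℝ} (0≤p : 0# ≤ p) (p≤1 : p ≤ 1#)
           (bound : abs (1# - p) ≤ ε * abs ((n ^1·5) ⁻¹)) where

    q : ℝ
    q = 1# - p

    0≤q : 0# ≤ q
    0≤q = x≤y⇒0≤y-x p≤1

    1≤t : 1# ≤ n ^1·5
    1≤t = 1≤n^1·5 (ℕ.≤-trans (ℕ.s≤s ℕ.z≤n) 4≤n)

    qt≤ε : q * n ^1·5 ≤ ε
    qt≤ε = ≤-inverse⇒*-≤ 0≤q 1≤t bound

    16q<½ : fromℕ 4 * (fromℕ 4 * q) < ½
    16q<½ = ≤-<-trans (*-monoˡ-≤ (fromℕ-nonNegative 4) (*-monoˡ-≤ (fromℕ-nonNegative 4) q≤ε))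
      (≤-<-trans (≤-reflexive 16ε≈¼) ¼<½)
      where
      q≤ε : q ≤ ε
      q≤ε = ≤-trans (≤-respˡ-≈ (*-identityʳ q) (*-monoˡ-≤ 0≤q 1≤t)) qt≤ε

    nnnqq≤½ : fromℕ n * (fromℕ n * (fromℕ n * (q * q))) ≤ ½
    nnnqq≤½ = ≤-trans (≤-respˡ-≈
      (trans (solve 2 (λ q t → q :* t :* (q :* t) := t :* t :* (q :* q)) refl q (n ^1·5))
        (trans (*-congʳ (n^1·5-squared n))
          (solve 2 (λ n x → n :* (n :* n) :* x := n :* (n :* (n :* x))) refl (fromℕ n) (q * q))))
      (square-mono-≤ (*-nonNegative 0≤q (≤-trans 0≤1 1≤t)) qt≤ε)) εε≤½

    largest≡4 : ∀ (P : LabelledGraph n → Subset n → Set) →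
      (∀ {G W} → P G W → IsDiameterGraph 3 (G [ W ]) × HasChromaticNumber (G [ W ]) 4) →
      (∀ {G W} → IsDiameterGraph 3 (G [ W ]) × HasChromaticNumber (G [ W ]) 4 × Connected (G [ W ])
        → P G W) →
      IsLargestPositiveOrZero (λ k → ½ < ℙ[ n , p ] (λ G → ∃ λ W → ∣ W ∣ ≡ k × P G W)) 4
    largest≡4 P P⇒ ⇒P = inj₁ (ℕ.s≤s ℕ.z≤n ,
      -- From 1 ≤ ℙ + 16q and 1 = ½ + ½ one gets ℙ - ½ ≥ ½ - 16q > 0.
      <-by-difference (<-≤-trans (x<y⇒0<y-x 16q<½)
          (≤-by-difference (x≤y⇒0≤y-x (ℙ-order≡4 0≤p p≤1 4≤n P ⇒P))
            (trans (solve 3 (λ x h c → x :- h :- (h :- c) := x :+ c :- (h :+ h)) refl _ ½ _)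
              (+-congˡ (-‿cong ½+½≈1))))) refl ,
      λ k _ ½<ℙ → ℕ.≮⇒≥ λ 4<k →
        <⇒≱ ½<ℙ (≤-trans (ℙ-order>4 0≤p p≤1 P 4<k P⇒) nnnqq≤½))

theorem20 : (em : ExcludedMiddle 0ℓ) (R : Reals) →
    let open RealOperations em R
        open RandomDiameterGraphs em R
    in (p : ℕ → ℝ) →
       (∀ n → 0# ≤ p n × p n ≤ 1#) →
       (λ n → 1# - p n) =o[ (λ n → (n ^1·5) ⁻¹) ] →
       ∃ λ N → ∀ n → N ℕ.≤ n → (u[ 3 , n , p n ]≡ 4) × (u′[ 3 , n , p n ]≡ 4)
theorem20 em R p p∈[0,1] 1-p=o =
  let open Asymptotics em R
      N , bound = 1-p=o ε 0<ε
  -- At least four vertices are required for a set W of size 4 to exist.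
  in 4 ℕ.⊔ N , λ n 4⊔N≤n →
       let 4≤n = ℕ.m⊔n≤o⇒m≤o 4 N 4⊔N≤n
           0≤p , p≤1 = p∈[0,1] n
           largest = largest≡4 4≤n 0≤p p≤1 (bound n (ℕ.m⊔n≤o⇒n≤o 4 N 4⊔N≤n))
       in largest _ (λ x → x) (λ (isDiameter , χ≡4 , _) → isDiameter , χ≡4) ,
          largest _ (λ (isDiameter , χ≡4 , _) → isDiameter , χ≡4) (λ x → x)
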